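{- Let $a,b\in\mathbb{C}$ with $|a|=|b|=1$, and let $H$ be either the $6\times 6$ complex Hadamard matrix $F(a,b)$ of the Fourier family or the $6\times 6$ complex Hadamard matrix $F^T(a,b)$ of the transposed Fourier family. Then $H$ cannot be extended to a full system of mutually unbiased complex Hadamard matrices in dimension $6$; that is, there do not exist $6\times 6$ complex Hadamard matrices $H_2,\dots,H_6$ such that the six matrices $H_1=H,H_2,\dots,H_6$ are pairwise unbiased.
   Context: An $n\times n$ complex Hadamard matrix is an $n\times n$ complex matrix all of whose entries have modulus $1$ and whose columns are pairwise orthogonal with respect to the standard Hermitian inner product on $\mathbb{C}^n$. Two $n\times n$ complex Hadamard matrices $H_1,H_2$ are called unbiased if $|\langle \mathbf u,\mathbf w\rangle|=\sqrt n$ for every column $\mathbf u$ of $H_1$ and every column $\mathbf w$ of $H_2$. A full system of mutually unbiased complex Hadamard matrices (MUHs) in dimension $n$ is a system of $n$ pairwise unbiased $n\times n$ complex Hadamard matrices. For unimodular $a,b$, let $\omega=e^{2\pi i/3}$ and $\mathbf f_0=(1,1,1)^T$, $\mathbf f_1=(1,\omega,\omega^{ -1})^T$, $\mathbf f_2=(1,\omega^{ -1},\omega)^T$. The matrix $F^T(a,b)$ (transposed Fourier family, up to permutation of rows and columns) is the $6\times 6$ matrix with columns, in block form, $$\begin{pmatrix}\mathbf f_0\\ \mathbf f_0\end{pmatrix},\ \begin{pmatrix}\mathbf f_0\\ -\mathbf f_0\end{pmatrix},\ \begin{pmatrix}\mathbf f_1\\ a\mathbf f_1\end{pmatrix},\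 \begin{pmatrix}\mathbf f_1\\ -a\mathbf f_1\end{pmatrix},\ \begin{pmatrix}\mathbf f_2\\ b\mathbf f_2\end{pmatrix},\ \begin{pmatrix}\mathbf f_2\\ -b\mathbf f_2\end{pmatrix},$$ and $F(a,b)$ (Fourier family) is the transpose of this matrix. -}

module Defs where

open import Algebra.Bundles.Raw using (RawMonoid)
import Algebra.Definitions.RawMonoid as RawMonoidDefs
open import Data.Fin.Base using (Fin)
open import Data.Integer.Base as ℤ using (+_; -[1+_])
import Data.Integer.Properties as ℤ
open import Data.Nat.Base as ℕ using (ℕ; zero; suc)
import Data.Nat.Properties as ℕ
open import Data.Product.Base using (∃; _×_; _,_)
open import Data.Rational.Base as ℚ using (ℚ; mkℚ; 0ℚ; 1ℚ; ½; -½; ↥_)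
import Data.Rational.Properties as ℚ
open import Data.Rational.Solver using (module +-*-Solver)
import Data.Rational.Unnormalised.Base as ℚᵘ
import Data.Rational.Unnormalised.Properties as ℚᵘ
open import Data.Sum.Base as Sum using (_⊎_; inj₁; inj₂)
open import Data.Vec.Functional using (Vector; []; _∷_; _++_; map; zipWith; transpose)
open import Level using (0ℓ)
open import Relation.Binary.PropositionalEquality
  using (_≡_; _≢_; refl; sym; trans; cong; subst; subst₂)
open import Relation.Nullary using (Dec; yes; no; ¬_; contradiction)

module ℚ-lemmas where
  0<½ε : ∀ {ε} → 0ℚ ℚ.< ε → 0ℚ ℚ.< ½ ℚ.* ε
  0<½ε {ε} ε>0 = ℚ.positive⁻¹ (½ ℚ.* ε) {{ℚ.pos*pos⇒pos ½ ε {{ℚ.positive ε>0}}}}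

  ½ε+½ε≡ε : ∀ ε → ½ ℚ.* ε ℚ.+ ½ ℚ.* ε ≡ ε
  ½ε+½ε≡ε = solve 1 (λ e → con ½ :* e :+ con ½ :* e := e) refl
    where open +-*-Solver

  +-<-halves : ∀ {p q ε} → p ℚ.< ½ ℚ.* ε → q ℚ.< ½ ℚ.* ε → p ℚ.+ q ℚ.< ε
  +-<-halves {ε = ε} p< q< = subst (_ ℚ.<_) (½ε+½ε≡ε ε) (ℚ.+-mono-< p< q<)

  ∣p-p∣≡0 : ∀ p → ℚ.∣ p ℚ.- p ∣ ≡ 0ℚ
  ∣p-p∣≡0 p = cong ℚ.∣_∣ (ℚ.+-inverseʳ p)

  ∣p∣≤∣q∣+∣p-q∣ : ∀ p q → ℚ.∣ p ∣ ℚ.≤ ℚ.∣ q ∣ ℚ.+ ℚ.∣ p ℚ.- q ∣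
  ∣p∣≤∣q∣+∣p-q∣ p q = subst (λ r → ℚ.∣ r ∣ ℚ.≤ ℚ.∣ q ∣ ℚ.+ ℚ.∣ p ℚ.- q ∣)
    (solve 2 (λ a b → b :+ (a :- b) := a) refl p q)
    (ℚ.∣p+q∣≤∣p∣+∣q∣ q (p ℚ.- q))
    where open +-*-Solver

  ∣p∣<ε : ∀ {p ε} → p ℚ.< ε → ℚ.- p ℚ.< ε → ℚ.∣ p ∣ ℚ.< ε
  ∣p∣<ε {p} p<ε -p<ε with ℚ.∣p∣≡p∨∣p∣≡-p p
  ... | inj₁ eq = subst (ℚ._< _) (sym eq) p<ε
  ... | inj₂ eq = subst (ℚ._< _) (sym eq) -p<ε

  p≤∣p∣ : ∀ p → p ℚ.≤ ℚ.∣ p ∣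
  p≤∣p∣ p with ℚ.≤-total 0ℚ p
  ... | inj₁ 0≤p = ℚ.≤-reflexive (sym (ℚ.0≤p⇒∣p∣≡p 0≤p))
  ... | inj₂ p≤0 = ℚ.≤-trans p≤0 (ℚ.0≤∣p∣ p)

  *-monoˡ-≤ : ∀ {r p q} → 0ℚ ℚ.≤ r → p ℚ.≤ q → r ℚ.* p ℚ.≤ r ℚ.* q
  *-monoˡ-≤ {r} 0≤r = ℚ.*-monoˡ-≤-nonNeg r {{ℚ.nonNegative 0≤r}}

  *-mono-≤ : ∀ {p q r s} → 0ℚ ℚ.≤ p → 0ℚ ℚ.≤ r → p ℚ.≤ q → r ℚ.≤ s → p ℚ.* r ℚ.≤ q ℚ.* s
  *-mono-≤ {p} {q} {r} {s} 0≤p 0≤r p≤q r≤s = ℚ.≤-trans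
    (*-monoˡ-≤ 0≤p r≤s)
    (ℚ.*-monoʳ-≤-nonNeg s {{ℚ.nonNegative (ℚ.≤-trans 0≤r r≤s)}} p≤q)

  /-mono-≤ : ∀ {i j m n} → i ℤ.* + suc n ℤ.≤ j ℤ.* + suc m → i ℚ./ suc m ℚ.≤ j ℚ./ suc n
  /-mono-≤ {i} {j} {m} {n} h = ℚ.toℚᵘ-cancel-≤
    (ℚᵘ.≤-respˡ-≃ (ℚᵘ.≃-sym (ℚ.toℚᵘ-fromℚᵘ (ℚᵘ.mkℚᵘ i m)))
    (ℚᵘ.≤-respʳ-≃ (ℚᵘ.≃-sym (ℚ.toℚᵘ-fromℚᵘ (ℚᵘ.mkℚᵘ j n)))
    (ℚᵘ.*≤* h)))

  δ : ℕ → ℚ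
  δ n = + 1 ℚ./ suc n

  grid : ℕ → ℕ → ℚ
  grid n j = + j ℚ./ suc n

  0≤grid : ∀ n j → 0ℚ ℚ.≤ grid n j
  0≤grid n j = /-mono-≤ {+ 0} {+ j} {0} {n} (subst (+ 0 ℤ.≤_) (sym (ℤ.*-identityʳ (+ j))) (ℤ.+≤+ ℕ.z≤n))

  0<δ : ∀ n → 0ℚ ℚ.< δ n
  0<δ n = ℚ.positive⁻¹ (δ n) {{ℚ.normalize-pos 1 (suc n)}}

  grid-suc : ∀ n j → grid n (suc j) ≡ grid n j ℚ.+ δ n
  grid-suc n j = ℚ.toℚᵘ-injective (ℚᵘ.≃-trans (ℚ.toℚᵘ-fromℚᵘ (ℚᵘ.mkℚᵘ (+ suc j) n))
    (ℚᵘ.≃-sym (ℚᵘ.≃-trans (ℚ.toℚᵘ-homo-+ (grid n j) (δ n))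
    (ℚᵘ.≃-trans (ℚᵘ.+-cong (ℚ.toℚᵘ-fromℚᵘ (ℚᵘ.mkℚᵘ (+ j) n)) (ℚ.toℚᵘ-fromℚᵘ (ℚᵘ.mkℚᵘ (+ 1) n)))
    (ℚᵘ.*≡* eq)))))
    where
    N = + suc n
    eq : (+ j ℤ.* N ℤ.+ + 1 ℤ.* N) ℤ.* N ≡ + suc j ℤ.* (N ℤ.* N)
    eq = trans (cong (ℤ._* N) (trans (sym (ℤ.*-distribʳ-+ N (+ j) (+ 1)))
      (cong (λ k → + k ℤ.* N) (ℕ.+-comm j 1)))) (ℤ.*-assoc (+ suc j) N N)

  archimedean : ∀ ε → 0ℚ ℚ.< ε → ∃ λ N → ∀ n → N ℕ.≤ n → δ n ℚ.< ε
  archimedean (mkℚ -[1+ _ ] _ _) (ℚ.*<* ())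
  archimedean (mkℚ (+ zero) _ _) (ℚ.*<* (ℤ.+<+ ()))
  archimedean ε@(mkℚ (+ suc a) d _) _ = suc d , λ n N≤n → ℚ.toℚᵘ-cancel-<
    (ℚᵘ.<-respˡ-≃ (ℚᵘ.≃-sym (ℚ.toℚᵘ-fromℚᵘ (ℚᵘ.mkℚᵘ (+ 1) n)))
    (ℚᵘ.*<* (subst (ℤ._< + suc a ℤ.* + suc n) (sym (ℤ.*-identityˡ (+ suc d)))
      (subst (+ suc d ℤ.<_) (ℤ.pos-* (suc a) (suc n))
        (ℤ.+<+ (ℕ.≤-trans (ℕ.s≤s N≤n) (ℕ.m≤m+n (suc n) (a ℕ.* suc n))))))))

open ℚ-lemmas

-- Real numbers are Cauchy sequences of rationals; `_≃_` (the difference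
-- tends to 0) is their equality.

Cauchy : (ℕ → ℚ) → Set
Cauchy x = ∀ ε → 0ℚ ℚ.< ε →
  ∃ λ N → ∀ m n → N ℕ.≤ m → N ℕ.≤ n → ℚ.∣ x m ℚ.- x n ∣ ℚ.< ε

record ℝ : Set where
  constructor mkℝ
  field
    seq    : ℕ → ℚ
    cauchy : Cauchy seq

open ℝ public

infix  4 _≃_ _≃ℂ_
infixl 6 _+ℝ_ _+ℂ_
infixl 7 _*ℝ_ _*ℂ_
infix  8 -ℝ_ -ℂ_

_≃_ : ℝ → ℝ → Set
x ≃ y = ∀ ε → 0ℚ ℚ.< ε →
  ∃ λ N → ∀ n → N ℕ.≤ n → ℚ.∣ seq x n ℚ.- seq y n ∣ ℚ.< ε

fromℚ : ℚ → ℝ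
fromℚ q = mkℝ (λ _ → q) λ ε ε>0 → 0 , λ _ _ _ _ → subst (ℚ._< ε) (sym (∣p-p∣≡0 q)) ε>0

fromℕ : ℕ → ℝ
fromℕ n = fromℚ (+ n ℚ./ 1)

0ℝ 1ℝ : ℝ
0ℝ = fromℚ 0ℚ
1ℝ = fromℚ 1ℚ

module Cauchy-lemmas where
  +-cauchy : ∀ {x y} → Cauchy x → Cauchy y → Cauchy (λ n → x n ℚ.+ y n)
  +-cauchy {x} {y} cx cy ε ε>0 with cx (½ ℚ.* ε) (0<½ε ε>0) | cy (½ ℚ.* ε) (0<½ε ε>0)
  ... | M , hx | N , hy = M ℕ.⊔ N , λ m n ≤m ≤n → ℚ.≤-<-trans
    (subst (λ r → ℚ.∣ r ∣ ℚ.≤ ℚ.∣ x m ℚ.- x n ∣ ℚ.+ ℚ.∣ y m ℚ.- y n ∣)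
      (solve 4 (λ a b c d → (a :- b) :+ (c :- d) := (a :+ c) :- (b :+ d)) refl
        (x m) (x n) (y m) (y n))
      (ℚ.∣p+q∣≤∣p∣+∣q∣ (x m ℚ.- x n) (y m ℚ.- y n)))
    (+-<-halves (hx m n (ℕ.m⊔n≤o⇒m≤o M N ≤m) (ℕ.m⊔n≤o⇒m≤o M N ≤n))
                (hy m n (ℕ.m⊔n≤o⇒n≤o M N ≤m) (ℕ.m⊔n≤o⇒n≤o M N ≤n)))
    where open +-*-Solver

  -‿cauchy : ∀ {x} → Cauchy x → Cauchy (λ n → ℚ.- x n)
  -‿cauchy {x} cx ε ε>0 with cx ε ε>0
  ... | N , h = N , λ m n ≤m ≤n → subst (ℚ._< ε)
    (trans (sym (ℚ.∣-p∣≡∣p∣ (x m ℚ.- x n)))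
      (cong ℚ.∣_∣ (ℚ.neg-distrib-+ (x m) (ℚ.- x n)))) (h m n ≤m ≤n)

  bounded : ∀ {x} → Cauchy x → ∃ λ B → ∃ λ N → ∀ n → N ℕ.≤ n → ℚ.∣ x n ∣ ℚ.≤ B
  bounded {x} cx with cx 1ℚ (ℚ.positive⁻¹ 1ℚ)
  ... | N , h = ℚ.∣ x N ∣ ℚ.+ 1ℚ , N , λ n N≤n → ℚ.≤-trans (∣p∣≤∣q∣+∣p-q∣ (x n) (x N))
    (ℚ.+-monoʳ-≤ ℚ.∣ x N ∣ (ℚ.<⇒≤ (h n N N≤n ℕ.≤-refl)))

  shrink : ∀ B ε → 0ℚ ℚ.< ε → ∃ λ η → 0ℚ ℚ.< η × (∀ {p q} → ℚ.∣ p ∣ ℚ.≤ B → ℚ.∣ q ∣ ℚ.< η → ℚ.∣ p ℚ.* q ∣ ℚ.< ε)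
  shrink B ε ε>0 = η , η>0 , bound
    where
    B⁺ = ℚ.∣ B ∣ ℚ.+ 1ℚ
    B⁺>0 : 0ℚ ℚ.< B⁺
    B⁺>0 = ℚ.+-mono-≤-< (ℚ.0≤∣p∣ B) (ℚ.positive⁻¹ 1ℚ)
    instance
      pos : ℚ.Positive B⁺
      pos = ℚ.positive B⁺>0
      nz : ℚ.NonZero B⁺
      nz = ℚ.pos⇒nonZero B⁺
      pos⁻¹ : ℚ.Positive (ℚ.1/ B⁺)
      pos⁻¹ = ℚ.1/pos⇒pos B⁺
    η = ε ℚ.* ℚ.1/ B⁺
    η>0 : 0ℚ ℚ.< η
    η>0 = ℚ.positive⁻¹ η {{ℚ.pos*pos⇒pos ε {{ℚ.positive ε>0}} (ℚ.1/ B⁺)}}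
    B⁺η≡ε : B⁺ ℚ.* η ≡ ε
    B⁺η≡ε = trans (solve 3 (λ b e i → b :* (e :* i) := e :* (b :* i)) refl B⁺ ε (ℚ.1/ B⁺))
      (trans (cong (ε ℚ.*_) (ℚ.*-inverseʳ B⁺)) (ℚ.*-identityʳ ε))
      where open +-*-Solver
    B≤B⁺ : B ℚ.≤ B⁺
    B≤B⁺ = ℚ.≤-trans (p≤∣p∣ B) (subst (ℚ._≤ B⁺) (ℚ.+-identityʳ _)
      (ℚ.+-monoʳ-≤ ℚ.∣ B ∣ (ℚ.<⇒≤ (ℚ.positive⁻¹ 1ℚ))))
    bound : ∀ {p q} → ℚ.∣ p ∣ ℚ.≤ B → ℚ.∣ q ∣ ℚ.< η → ℚ.∣ p ℚ.* q ∣ ℚ.< ε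
    bound {p} {q} p≤ q< = begin-strict
      ℚ.∣ p ℚ.* q ∣         ≡⟨ ℚ.∣p*q∣≡∣p∣*∣q∣ p q ⟩
      ℚ.∣ p ∣ ℚ.* ℚ.∣ q ∣   ≤⟨ ℚ.*-monoʳ-≤-nonNeg ℚ.∣ q ∣ {{ℚ.∣-∣-nonNeg q}} (ℚ.≤-trans p≤ B≤B⁺) ⟩
      B⁺ ℚ.* ℚ.∣ q ∣        <⟨ ℚ.*-monoʳ-<-pos B⁺ q< ⟩
      B⁺ ℚ.* η              ≡⟨ B⁺η≡ε ⟩
      ε                     ∎
      where open ℚ.≤-Reasoning

  *-cauchy : ∀ {x y} → Cauchy x → Cauchy y → Cauchy (λ n → x n ℚ.* y n)
  *-cauchy {x} {y} cx cy ε ε>0 =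
    let (A , K , A≥) = bounded {x} cx
        (B , L , B≥) = bounded {y} cy
        (η , η>0 , hη) = shrink A (½ ℚ.* ε) (0<½ε ε>0)
        (θ , θ>0 , hθ) = shrink B (½ ℚ.* ε) (0<½ε ε>0)
        (M , hx) = cx θ θ>0
        (N , hy) = cy η η>0
        P = K ℕ.⊔ L
        Q = M ℕ.⊔ N
    in P ℕ.⊔ Q , λ m n ≤m ≤n →
      let P≤m = ℕ.m⊔n≤o⇒m≤o P Q ≤m
          P≤n = ℕ.m⊔n≤o⇒m≤o P Q ≤n
          Q≤m = ℕ.m⊔n≤o⇒n≤o P Q ≤m
          Q≤n = ℕ.m⊔n≤o⇒n≤o P Q ≤n
      in ℚ.≤-<-trans
        (subst (λ r → ℚ.∣ r ∣ ℚ.≤ ℚ.∣ x m ℚ.* (y m ℚ.- y n) ∣ ℚ.+ ℚ.∣ y n ℚ.* (x m ℚ.- x n) ∣)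
          (solve 4 (λ a b c d → a :* (c :- d) :+ d :* (a :- b) := a :* c :- b :* d) refl
            (x m) (x n) (y m) (y n))
          (ℚ.∣p+q∣≤∣p∣+∣q∣ (x m ℚ.* (y m ℚ.- y n)) (y n ℚ.* (x m ℚ.- x n))))
        (+-<-halves
          (hη {x m} {y m ℚ.- y n} (A≥ m (ℕ.m⊔n≤o⇒m≤o K L P≤m))
              (hy m n (ℕ.m⊔n≤o⇒n≤o M N Q≤m) (ℕ.m⊔n≤o⇒n≤o M N Q≤n)))
          (hθ {y n} {x m ℚ.- x n} (B≥ n (ℕ.m⊔n≤o⇒n≤o K L P≤n))
              (hx m n (ℕ.m⊔n≤o⇒m≤o M N Q≤m) (ℕ.m⊔n≤o⇒m≤o M N Q≤n))))
    where open +-*-Solver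

open Cauchy-lemmas

_+ℝ_ : ℝ → ℝ → ℝ
x +ℝ y = mkℝ (λ n → seq x n ℚ.+ seq y n) (+-cauchy {seq x} {seq y} (cauchy x) (cauchy y))

-ℝ_ : ℝ → ℝ
-ℝ x = mkℝ (λ n → ℚ.- seq x n) (-‿cauchy {seq x} (cauchy x))

_*ℝ_ : ℝ → ℝ → ℝ
x *ℝ y = mkℝ (λ n → seq x n ℚ.* seq y n) (*-cauchy {seq x} {seq y} (cauchy x) (cauchy y))

-- The largest j ≤ k satisfying P, or 0 if there is none.

largest : ∀ {P : ℕ → Set} → (∀ j → Dec (P j)) → ℕ → ℕ
largest P? zero    = zero
largest P? (suc k) with P? (suc k)
... | yes _ = suc k
... | no  _ = largest P? k

-- Largest j / (n + 1) with j ≤ k whose square is at most q, or 0.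

gridRoot : ℕ → ℕ → ℚ → ℚ
gridRoot n k q =
  + largest (λ j → (+ j ℚ./ suc n) ℚ.* (+ j ℚ./ suc n) ℚ.≤? q) k ℚ./ suc n

-- Largest multiple of 1 / (n + 1) whose square is at most q; it is 0 for
-- q < 0.  The search range is large enough because √ q ≤ 1 + ∣ ↥ q ∣.
-- Opaque to keep conversion checking away from ℚ normalisation;
-- √ℚ-nonNeg, √ℚ-lower and √ℚ-upper pin it down to within 1 / (n + 1).

opaque
  √ℚ : ℕ → ℚ → ℚ
  √ℚ n q = gridRoot n (suc n ℕ.* suc ℤ.∣ ↥ q ∣) q

module search-lemmas where
  module _ {P : ℕ → Set} (P? : ∀ j → Dec (P j)) where

    largest-sat : ∀ k → largest P? k ≡ 0 ⊎ P (largest P? k)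
    largest-sat zero    = inj₁ refl
    largest-sat (suc k) with P? (suc k)
    ... | yes p = inj₂ p
    ... | no  _ = largest-sat k

    largest-max : ∀ k → ¬ P (suc k) → ¬ P (suc (largest P? k))
    largest-max zero    ¬p = ¬p
    largest-max (suc k) ¬p with P? (suc k)
    ... | yes _   = ¬p
    ... | no  ¬p′ = largest-max k ¬p′

  q≤∣↥q∣ : ∀ q → q ℚ.≤ + ℤ.∣ ↥ q ∣ ℚ./ 1
  q≤∣↥q∣ q@(mkℚ i d _) = ℚ.toℚᵘ-cancel-≤
    (ℚᵘ.≤-respʳ-≃ (ℚᵘ.≃-sym (ℚ.toℚᵘ-fromℚᵘ (ℚᵘ.mkℚᵘ (+ ℤ.∣ i ∣) 0)))
    (ℚᵘ.*≤* (lemma i)))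
    where
    lemma : ∀ i → i ℤ.* + 1 ℤ.≤ + ℤ.∣ i ∣ ℤ.* + suc d
    lemma (+ a)    = subst₂ ℤ._≤_ (sym (ℤ.*-identityʳ (+ a))) (ℤ.pos-* a (suc d)) (ℤ.+≤+ (ℕ.m≤m*n a (suc d)))
    lemma -[1+ a ] = ℤ.-≤+

  grid-start : ∀ n q → let k = suc n ℕ.* suc ℤ.∣ ↥ q ∣ in
    q ℚ.< grid n (suc k) ℚ.* grid n (suc k)
  grid-start n q = begin-strict
    q                          ≤⟨ q≤∣↥q∣ q ⟩
    grid 0 a                   <⟨ subst (grid 0 a ℚ.<_) (sym (grid-suc 0 a)) (subst (ℚ._< grid 0 a ℚ.+ δ 0) (ℚ.+-identityʳ _) (ℚ.+-monoʳ-< (grid 0 a) (0<δ 0))) ⟩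
    grid 0 (suc a)             ≡⟨ sym (ℚ.*-identityʳ _) ⟩
    grid 0 (suc a) ℚ.* 1ℚ      ≤⟨ *-mono-≤ (0≤grid 0 (suc a)) (ℚ.<⇒≤ (ℚ.positive⁻¹ 1ℚ)) big (ℚ.≤-trans one≤ big) ⟩
    grid n (suc k) ℚ.* grid n (suc k) ∎
    where
    open ℚ.≤-Reasoning
    a = ℤ.∣ ↥ q ∣
    k = suc n ℕ.* suc a
    big : grid 0 (suc a) ℚ.≤ grid n (suc k)
    big = /-mono-≤ {+ suc a} {+ suc k} {0} {n}
      (subst₂ ℤ._≤_ (ℤ.pos-* (suc a) (suc n)) (sym (ℤ.*-identityʳ (+ suc k)))
        (ℤ.+≤+ (ℕ.≤-trans (ℕ.≤-reflexive (ℕ.*-comm (suc a) (suc n))) (ℕ.n≤1+n k))))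
    one≤ : 1ℚ ℚ.≤ grid 0 (suc a)
    one≤ = /-mono-≤ {+ 1} {+ suc a} {0} {0} (subst (+ 1 ℤ.≤_) (sym (ℤ.*-identityʳ (+ suc a))) (ℤ.+≤+ (ℕ.s≤s ℕ.z≤n)))

open search-lemmas

module gridRoot-lemmas where
  gridRoot-nonNeg : ∀ n k q → 0ℚ ℚ.≤ gridRoot n k q
  gridRoot-nonNeg n k q = 0≤grid n (largest (λ j → grid n j ℚ.* grid n j ℚ.≤? q) k)

  gridRoot-lower : ∀ n k q → gridRoot n k q ≡ 0ℚ ⊎ gridRoot n k q ℚ.* gridRoot n k q ℚ.≤ q
  gridRoot-lower n k q =
    Sum.map₁ (λ eq → trans (cong (grid n) eq) (ℚ.0/n≡0 (suc n)))
      (largest-sat {P = λ j → grid n j ℚ.* grid n j ℚ.≤ q} (λ j → grid n j ℚ.* grid n j ℚ.≤? q) k)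

  gridRoot-upper : ∀ n k q → q ℚ.< grid n (suc k) ℚ.* grid n (suc k) →
    q ℚ.< (gridRoot n k q ℚ.+ δ n) ℚ.* (gridRoot n k q ℚ.+ δ n)
  gridRoot-upper n k q q< = subst (λ r → q ℚ.< r ℚ.* r) (grid-suc n j)
    (ℚ.≰⇒> (largest-max {P = λ j → grid n j ℚ.* grid n j ℚ.≤ q} P? k
      (λ ≤q → ℚ.<-irrefl refl (ℚ.<-≤-trans q< ≤q))))
    where
    P? = λ j → grid n j ℚ.* grid n j ℚ.≤? q
    j = largest P? k

open gridRoot-lemmas

opaque
  unfolding √ℚ

  √ℚ-nonNeg : ∀ n q → 0ℚ ℚ.≤ √ℚ n q
  √ℚ-nonNeg n q = gridRoot-nonNeg n (suc n ℕ.* suc ℤ.∣ ↥ q ∣) q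

  √ℚ-lower : ∀ n q → √ℚ n q ≡ 0ℚ ⊎ √ℚ n q ℚ.* √ℚ n q ℚ.≤ q
  √ℚ-lower n q = gridRoot-lower n (suc n ℕ.* suc ℤ.∣ ↥ q ∣) q

  √ℚ-upper : ∀ n q → q ℚ.< (√ℚ n q ℚ.+ + 1 ℚ./ suc n) ℚ.* (√ℚ n q ℚ.+ + 1 ℚ./ suc n)
  √ℚ-upper n q = gridRoot-upper n (suc n ℕ.* suc ℤ.∣ ↥ q ∣) q (grid-start n q)

module √-lemmas where
  root-close : ∀ {p q s t d ε} → s ≡ 0ℚ ⊎ s ℚ.* s ℚ.≤ p →
    0ℚ ℚ.≤ t → q ℚ.< (t ℚ.+ d) ℚ.* (t ℚ.+ d) → 0ℚ ℚ.< d → 0ℚ ℚ.< ε →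
    ℚ.∣ p ℚ.- q ∣ ℚ.< (½ ℚ.* ε) ℚ.* (½ ℚ.* ε) → d ℚ.< ½ ℚ.* ε → s ℚ.- t ℚ.< ε
  root-close {p} {q} {s} {t} {d} {ε} s-root 0≤t q< 0<d ε>0 p-q< d< with s ℚ.- t ℚ.<? ε
  ... | yes s-t<ε = s-t<ε
  ... | no  ≮ε = contradiction (ℚ.≤-<-trans h² (ℚ.≤-<-trans (p≤∣p∣ _) p-q<)) (ℚ.<-irrefl refl)
    where
    open +-*-Solver
    h = ½ ℚ.* ε
    u = t ℚ.+ d
    0≤h : 0ℚ ℚ.≤ h
    0≤h = ℚ.<⇒≤ (0<½ε ε>0)
    0≤u : 0ℚ ℚ.≤ u
    0≤u = ℚ.+-mono-≤ 0≤t (ℚ.<⇒≤ 0<d)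
    u+h≤s : u ℚ.+ h ℚ.≤ s
    u+h≤s = begin
      (t ℚ.+ d) ℚ.+ h  ≤⟨ ℚ.+-monoˡ-≤ h (ℚ.+-monoʳ-≤ t (ℚ.<⇒≤ d<)) ⟩
      (t ℚ.+ h) ℚ.+ h    ≡⟨ ℚ.+-assoc t h h ⟩
      t ℚ.+ (h ℚ.+ h)    ≡⟨ cong (t ℚ.+_) (½ε+½ε≡ε ε) ⟩
      t ℚ.+ ε            ≤⟨ ℚ.+-monoʳ-≤ t (ℚ.≮⇒≥ ≮ε) ⟩
      t ℚ.+ (s ℚ.- t)    ≡⟨ solve 2 (λ a b → b :+ (a :- b) := a) refl s t ⟩
      s                  ∎
      where open ℚ.≤-Reasoning
    0<u+h : 0ℚ ℚ.< u ℚ.+ h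
    0<u+h = ℚ.+-mono-≤-< 0≤u (0<½ε ε>0)
    s²≤p : s ℚ.* s ℚ.≤ p
    s²≤p = Sum.[ (λ s≡0 → contradiction
      (ℚ.<-≤-trans 0<u+h (subst (u ℚ.+ h ℚ.≤_) s≡0 u+h≤s)) (ℚ.<-irrefl refl)) , (λ s²≤ → s²≤) ]′ s-root
    h² : h ℚ.* h ℚ.≤ p ℚ.- q
    h² = begin
      h ℚ.* h                                      ≡⟨ solve 2 (λ a b → b :* b := (a :* a :+ b :* b) :- a :* a) refl u h ⟩
      (u ℚ.* u ℚ.+ h ℚ.* h) ℚ.- u ℚ.* u            ≤⟨ ℚ.+-mono-≤ lem (ℚ.neg-antimono-≤ (ℚ.<⇒≤ q<)) ⟩
      p ℚ.- q                                      ∎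
      where
      open ℚ.≤-Reasoning
      lem : u ℚ.* u ℚ.+ h ℚ.* h ℚ.≤ p
      lem = begin
        u ℚ.* u ℚ.+ h ℚ.* h                              ≡⟨ sym (ℚ.+-identityʳ _) ⟩
        (u ℚ.* u ℚ.+ h ℚ.* h) ℚ.+ 0ℚ                     ≤⟨ ℚ.+-monoʳ-≤ (u ℚ.* u ℚ.+ h ℚ.* h) (ℚ.+-mono-≤ uh uh) ⟩
        (u ℚ.* u ℚ.+ h ℚ.* h) ℚ.+ (u ℚ.* h ℚ.+ u ℚ.* h)  ≡⟨ solve 2 (λ a b → (a :* a :+ b :* b) :+ (a :* b :+ a :* b) := (a :+ b) :* (a :+ b)) refl u h ⟩
        (u ℚ.+ h) ℚ.* (u ℚ.+ h)                          ≤⟨ *-mono-≤ (ℚ.<⇒≤ 0<u+h) (ℚ.<⇒≤ 0<u+h) u+h≤s u+h≤s ⟩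
        s ℚ.* s                                          ≤⟨ s²≤p ⟩
        p                                                ∎
        where
        uh : 0ℚ ℚ.≤ u ℚ.* h
        uh = subst (ℚ._≤ u ℚ.* h) (ℚ.*-zeroʳ u) (*-monoˡ-≤ 0≤u 0≤h)

  √-close : ∀ {p q ε} m n → 0ℚ ℚ.< ε → ℚ.∣ p ℚ.- q ∣ ℚ.< (½ ℚ.* ε) ℚ.* (½ ℚ.* ε) →
    δ n ℚ.< ½ ℚ.* ε → √ℚ m p ℚ.- √ℚ n q ℚ.< ε
  √-close {p} {q} m n =
    root-close {p} {q} {√ℚ m p} {√ℚ n q} {δ n} (√ℚ-lower m p) (√ℚ-nonNeg n q) (√ℚ-upper n q) (0<δ n)

  √-cauchy : ∀ {x} → Cauchy x → Cauchy (λ n → √ℚ n (x n))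
  √-cauchy {x} cx ε ε>0 =
    let h>0 = 0<½ε ε>0
        h = ½ ℚ.* ε
        (M , hx) = cx (h ℚ.* h) (ℚ.positive⁻¹ (h ℚ.* h) {{ℚ.pos*pos⇒pos h {{ℚ.positive h>0}} h {{ℚ.positive h>0}}}})
        (N , hδ) = archimedean h h>0
    in M ℕ.⊔ N , λ m n ≤m ≤n →
      let M≤m = ℕ.m⊔n≤o⇒m≤o M N ≤m
          M≤n = ℕ.m⊔n≤o⇒m≤o M N ≤n
          N≤m = ℕ.m⊔n≤o⇒n≤o M N ≤m
          N≤n = ℕ.m⊔n≤o⇒n≤o M N ≤n
      in ∣p∣<ε (√-close m n ε>0 (hx m n M≤m M≤n) (hδ n N≤n))
        (subst (ℚ._< ε)
          (solve 2 (λ a b → b :- a := :- (a :- b)) refl (√ℚ m (x m)) (√ℚ n (x n)))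
          (√-close n m ε>0 (hx n m M≤n M≤m) (hδ m N≤m)))
    where open +-*-Solver

open √-lemmas

-- Total; on negative reals the value is 0.

√_ : ℝ → ℝ
√ x = mkℝ (λ n → √ℚ n (seq x n)) (√-cauchy {seq x} (cauchy x))

infix 8 √_

infix 5 _+i_

record ℂ : Set where
  constructor _+i_
  field
    re im : ℝ

open ℂ public

_≃ℂ_ : ℂ → ℂ → Set
z ≃ℂ w = re z ≃ re w × im z ≃ im w

0ℂ 1ℂ : ℂ
0ℂ = 0ℝ +i 0ℝ
1ℂ = 1ℝ +i 0ℝ

_+ℂ_ : ℂ → ℂ → ℂ
z +ℂ w = (re z +ℝ re w) +i (im z +ℝ im w)

-ℂ_ : ℂ → ℂ
-ℂ z = (-ℝ re z) +i (-ℝ im z)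

_*ℂ_ : ℂ → ℂ → ℂ
z *ℂ w = (re z *ℝ re w +ℝ -ℝ (im z *ℝ im w)) +i (re z *ℝ im w +ℝ im z *ℝ re w)

conj : ℂ → ℂ
conj z = re z +i (-ℝ im z)

∣_∣ : ℂ → ℝ
∣ z ∣ = √ (re z *ℝ re z +ℝ im z *ℝ im z)

+ℂ-rawMonoid : RawMonoid 0ℓ 0ℓ
+ℂ-rawMonoid = record { _≈_ = _≃ℂ_ ; _∙_ = _+ℂ_ ; ε = 0ℂ }

open RawMonoidDefs +ℂ-rawMonoid public using (sum)

-- H i j is the entry in row i and column j.

Matrix : ℕ → Set
Matrix n = Vector (Vector ℂ n) n

column : ∀ {n} → Matrix n → Fin n → Vector ℂ n
column H j = transpose H j

⟨_,_⟩ : ∀ {n} → Vector ℂ n → Vector ℂ n → ℂ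
⟨ u , w ⟩ = sum (zipWith (λ x y → conj x *ℂ y) u w)

IsComplexHadamard : ∀ {n} → Matrix n → Set
IsComplexHadamard H =
  (∀ i j → ∣ H i j ∣ ≃ 1ℝ) ×
  (∀ j k → j ≢ k → ⟨ column H j , column H k ⟩ ≃ℂ 0ℂ)

Unbiased : ∀ {n} → Matrix n → Matrix n → Set
Unbiased {n} H K = ∀ j k → ∣ ⟨ column H j , column K k ⟩ ∣ ≃ √ fromℕ n

IsFullMUHSystem : ∀ {n} → Vector (Matrix n) n → Set
IsFullMUHSystem Hs =
  (∀ i → IsComplexHadamard (Hs i)) ×
  (∀ i j → i ≢ j → Unbiased (Hs i) (Hs j))

ExtendsToFullMUHSystem : ∀ {n} → Matrix (suc n) → Set
ExtendsToFullMUHSystem {n} H =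
  ∃ λ (Hs : Vector (Matrix (suc n)) n) → IsFullMUHSystem (H ∷ Hs)

-- e^{2πi/3} in Cartesian form.

ω : ℂ
ω = fromℚ -½ +i (fromℚ ½ *ℝ √ fromℕ 3)

-- ω has modulus 1, so its inverse is its conjugate.

ω⁻¹ : ℂ
ω⁻¹ = conj ω

f₀ f₁ f₂ : Vector ℂ 3
f₀ = 1ℂ ∷ 1ℂ  ∷ 1ℂ  ∷ []
f₁ = 1ℂ ∷ ω   ∷ ω⁻¹ ∷ []
f₂ = 1ℂ ∷ ω⁻¹ ∷ ω   ∷ []

Fᵀ-columns : ℂ → ℂ → Vector (Vector ℂ 6) 6
Fᵀ-columns a b =
    (f₀ ++ f₀)
  ∷ (f₀ ++ map -ℂ_ f₀)
  ∷ (f₁ ++ map (a *ℂ_) f₁)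
  ∷ (f₁ ++ map ((-ℂ a) *ℂ_) f₁)
  ∷ (f₂ ++ map (b *ℂ_) f₂)
  ∷ (f₂ ++ map ((-ℂ b) *ℂ_) f₂)
  ∷ []

Fᵀ : ℂ → ℂ → Matrix 6
Fᵀ a b = transpose (Fᵀ-columns a b)

F : ℂ → ℂ → Matrix 6
F a b = transpose (Fᵀ a b)

{-# OPTIONS --safe #-}
module Submission where

-- Counting fourth powers of inner products over the 36 columns v of a full system shows that
-- the moments Σ v_a v_b v̄_c v̄_d vanish unless {a, b} = {c, d}: the sum over all (a, b, c, d) of
-- their squared moduli is Σ_{u,v} ∣⟨u, v⟩∣⁴ = 85536, which the 66 trivial moments, each equal
-- to 36, already exhaust.  When the first matrix is H, its columns have all values 1 at certain
-- nontrivial monomials, so the sums of these over the other 30 columns are known to be -6.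
--
-- For H = Fᵀ(a, b), put c = v₁v̄₂ + v₂v̄₃ + v₃v̄₁ and let c′ be its analogue on the last three
-- entries.  Unbiasedness with H forces c′ = -c, whence
-- ∣v₁³ + v₂³ + v₃³∣² + ∣v₄³ + v₅³ + v₆³∣² = 18 - 12 ∣c∣² ≥ 0, so the other columns contribute at
-- most 30 · 3/2 = 45 to Σ ∣c∣², but the moments give 54.
--
-- For H = F(a, b), let P, Q, R be 2 Re v₁v̄₂, 2 Re v₃v̄₄, 2 Re v₅v̄₆.  The sums s = (v₁ + v₂, …)
-- satisfy ∣s₁∣² + ∣s₂∣² + ∣s₃∣² = 6 and s₁s̄₂ + s₂s̄₃ + s₃s̄₁ = 0, and so do the (rotated) differences.
-- The second equation closes a triangle, so Heron's formula bounds polynomials in P, Q, R from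
-- below; adding both bounds gives PQ + QR + RP ≥ -2 for each of the other columns, while the
-- moments give a total of -72 < -60.

open import Algebra.Bundles using (CommutativeRing)
import Algebra.Properties.Semiring.Sum as SemiringSum
import Algebra.Solver.Ring as RingSolver
open import Algebra.Solver.Ring.AlmostCommutativeRing
  using (fromCommutativeRing; _-Raw-AlmostCommutative⟶_)
open import Algebra.Structures using (IsCommutativeRing)
open import Data.Bool.Base using (Bool; true; false; not; T; if_then_else_; _∧_; _∨_)
open import Data.Empty using (⊥)
open import Data.Fin.Base using (Fin; zero; suc; punchIn; _↑ˡ_; _↑ʳ_)
open import Data.Fin.Patterns
open import Data.Fin.Properties using (_≟_)
open import Data.Integer.Base as ℤ using (ℤ; +_; -[1+_])
import Data.Integer.Properties as ℤ
open import Data.List.Base using (List; []; _∷_)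
open import Data.Maybe.Base using (Maybe; just; nothing; is-just)
open import Data.Nat.Base as ℕ using (ℕ; zero; suc)
import Data.Nat.Properties as ℕ
open import Data.Product using (∃; _×_; _,_; proj₁; proj₂)
open import Data.Rational.Base as ℚ using (ℚ; 0ℚ; 1ℚ; ½)
import Data.Rational.Properties as ℚ
open import Data.Rational.Solver using (module +-*-Solver)
import Data.Rational.Unnormalised.Base as ℚᵘ
import Data.Rational.Unnormalised.Properties as ℚᵘ
open import Data.Sum.Base using (inj₁; inj₂)
open import Data.Unit.Base using (⊤; tt)
open import Data.Vec.Base as Vec using (Vec)
open import Data.Vec.Functional as V using (Vector) renaming ([] to []ᵛ; _∷_ to _∷ᵛ_; _++_ to _++ᵛ_; map to mapᵛ)
open import Data.Vec.Functional.Properties using (++-cong)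
open import Data.Vec.N-ary using (N-ary; _$ⁿ_; curryⁿ; Eq; curryⁿ-cong)
open import Data.Vec.Properties using (lookup-++ˡ; lookup-++ʳ; lookup-map)
open import Level using (0ℓ)
open import Relation.Binary.PropositionalEquality as ≡ using (_≡_; _≢_)
open import Relation.Binary.Structures using (IsEquivalence)
open import Relation.Nullary using (¬_; yes; no; does)

-- Commutative rings with an involution and a positive cone

-- Pos x models Re x ≥ 0; x need not be self-conjugate.

record IsPositiveStarRing {A : Set} (_≈_ : A → A → Set) (_+_ _*_ : A → A → A) (-_ : A → A) (0# 1# : A)
  (ι : ℤ → A) (_ᶜ : A → A) (Pos : A → Set) : Set where
  field
    isCommutativeRing : IsCommutativeRing _≈_ _+_ _*_ -_ 0# 1#
    ι-+      : ∀ i j → ι (i ℤ.+ j) ≈ (ι i + ι j)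
    ι-*      : ∀ i j → ι (i ℤ.* j) ≈ (ι i * ι j)
    ι-neg    : ∀ i → ι (ℤ.- i) ≈ (- ι i)
    ι-0      : ι (+ 0) ≈ 0#
    ι-1      : ι (+ 1) ≈ 1#
    ᶜ-cong   : ∀ {x y} → x ≈ y → (x ᶜ) ≈ (y ᶜ)
    ᶜ-+      : ∀ x y → ((x + y) ᶜ) ≈ ((x ᶜ) + (y ᶜ))
    ᶜ-*      : ∀ x y → ((x * y) ᶜ) ≈ ((x ᶜ) * (y ᶜ))
    ᶜ-neg    : ∀ x → ((- x) ᶜ) ≈ (- (x ᶜ))
    ᶜ-ι      : ∀ i → (ι i ᶜ) ≈ ι i
    ᶜ-invol  : ∀ x → ((x ᶜ) ᶜ) ≈ x
    Pos-resp : ∀ {x y} → x ≈ y → Pos x → Pos y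
    Pos-+    : ∀ {x y} → Pos x → Pos y → Pos (x + y)
    Pos-sq   : ∀ x → Pos (x * (x ᶜ))
    ¬Pos-neg : ¬ Pos (ι -[1+ 0 ])
    cancel₆  : ∀ {x} → (ι (+ 6) * x) ≈ ι (+ 0) → x ≈ ι (+ 0)

-- Everything up to the contradiction uses only these axioms, so the algebra is done over an
-- abstract carrier and never meets Cauchy sequences; `ℂ` enters at the end through
-- `ℂ-positiveStarRing`.
record PositiveStarRing : Set₁ where
  infix  9 _ᶜ
  infix  8 -_
  infixl 7 _*_
  infixl 6 _+_
  infix  4 _≈_
  field
    Carrier : Set
    _≈_     : Carrier → Carrier → Set
    _+_ _*_ : Carrier → Carrier → Carrier
    -_      : Carrier → Carrier
    0# 1#   : Carrier
    ι       : ℤ → Carrier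
    _ᶜ      : Carrier → Carrier
    Pos     : Carrier → Set
    isPositiveStarRing : IsPositiveStarRing _≈_ _+_ _*_ -_ 0# 1# ι _ᶜ Pos
  open IsPositiveStarRing isPositiveStarRing public

  commutativeRing : CommutativeRing 0ℓ 0ℓ
  commutativeRing = record { isCommutativeRing = isCommutativeRing }
  open CommutativeRing commutativeRing public
    hiding (Carrier; _≈_; _+_; _*_; -_; 0#; 1#; isCommutativeRing; zero)

-- Reflective solver for identities in a ring with involution

module StarSolver (S : PositiveStarRing) where
  open PositiveStarRing S

  private
    morphism : ℤ.+-*-rawRing -Raw-AlmostCommutative⟶ fromCommutativeRing commutativeRing
    morphism = record
      { ⟦_⟧ = ι ; +-homo = ι-+ ; *-homo = ι-* ; -‿homo = ι-neg ; 0-homo = ι-0 ; 1-homo = ι-1 }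

    decide : ∀ i j → Maybe (ι i ≈ ι j)
    decide i j with i ℤ.≟ j
    ... | yes eq = just (reflexive (≡.cong ι eq))
    ... | no  _  = nothing

  open RingSolver ℤ.+-*-rawRing (fromCommutativeRing commutativeRing) morphism decide
    using (Polynomial; op; con; var; [+]; [*]; :-_; Normal; normalise; _≟N_; ⟦_⟧N-cong)
    renaming (⟦_⟧ to ⟦_⟧ₚ; ⟦_⟧↓ to ⟦_⟧ₚ↓; correct to correctₚ)
  open import Relation.Binary.Reasoning.Setoid setoid

  infixl 6 _⊕_ _⊖_
  infixl 7 _⊗_
  infix  8 ⊝_
  infix  9 _⋆
  infix  4 _≐_

  data Expr (n : ℕ) : Set where
    #_  : ℤ → Expr n
    `_  : Fin n → Expr n
    _⊕_ _⊗_ : Expr n → Expr n → Expr n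
    ⊝_ _⋆ : Expr n → Expr n

  _⊖_ : ∀ {n} → Expr n → Expr n → Expr n
  s ⊖ t = s ⊕ ⊝ t

  ⟦_⟧ : ∀ {n} → Expr n → Vec Carrier n → Carrier
  ⟦ # i ⟧   ρ = ι i
  ⟦ ` x ⟧   ρ = Vec.lookup ρ x
  ⟦ s ⊕ t ⟧ ρ = ⟦ s ⟧ ρ + ⟦ t ⟧ ρ
  ⟦ s ⊗ t ⟧ ρ = ⟦ s ⟧ ρ * ⟦ t ⟧ ρ
  ⟦ ⊝ t ⟧   ρ = - ⟦ t ⟧ ρ
  ⟦ t ⋆ ⟧   ρ = ⟦ t ⟧ ρ ᶜ

  star : Bool → Carrier → Carrier
  star false x = x
  star true  x = x ᶜ

  -- The variable x of Expr n becomes two independent variables of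
  -- Polynomial (n + n), one for x and one for its conjugate.

  index : ∀ {n} → Bool → Fin n → Fin (n ℕ.+ n)
  index {n} false x = x ↑ˡ n
  index {n} true  x = n ↑ʳ x

  -- The Boolean is the parity of the conjugations around the current subterm. It is pushed down to
  -- the variables, so the resulting polynomial contains no involution.
  compile : ∀ {n} → Bool → Expr n → Polynomial (n ℕ.+ n)
  compile b (# i)   = con i
  compile b (` x)   = var (index b x)
  compile b (s ⊕ t) = op [+] (compile b s) (compile b t)
  compile b (s ⊗ t) = op [*] (compile b s) (compile b t)
  compile b (⊝ t)   = :- compile b t
  compile b (t ⋆)   = compile (not b) t

  double : ∀ {n} → Vec Carrier n → Vec Carrier (n ℕ.+ n)
  double ρ = ρ Vec.++ Vec.map _ᶜ ρ

  lookup-index : ∀ {n} b (x : Fin n) ρ → Vec.lookup (double ρ) (index b x) ≡ star b (Vec.lookup ρ x)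
  lookup-index false x ρ = lookup-++ˡ ρ (Vec.map _ᶜ ρ) x
  lookup-index true  x ρ = ≡.trans (lookup-++ʳ ρ (Vec.map _ᶜ ρ) x) (lookup-map x _ᶜ ρ)

  compile-correct : ∀ {n} b (t : Expr n) ρ → ⟦ compile b t ⟧ₚ (double ρ) ≈ star b (⟦ t ⟧ ρ)
  compile-correct false (# i)   ρ = refl
  compile-correct true  (# i)   ρ = sym (ᶜ-ι i)
  compile-correct b     (` x)   ρ = reflexive (lookup-index b x ρ)
  compile-correct false (s ⊕ t) ρ = +-cong (compile-correct false s ρ) (compile-correct false t ρ)
  compile-correct true  (s ⊕ t) ρ = trans (+-cong (compile-correct true s ρ) (compile-correct true t ρ)) (sym (ᶜ-+ _ _))
  compile-correct false (s ⊗ t) ρ = *-cong (compile-correct false s ρ) (compile-correct false t ρ)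
  compile-correct true  (s ⊗ t) ρ = trans (*-cong (compile-correct true s ρ) (compile-correct true t ρ)) (sym (ᶜ-* _ _))
  compile-correct false (⊝ t)   ρ = -‿cong (compile-correct false t ρ)
  compile-correct true  (⊝ t)   ρ = trans (-‿cong (compile-correct true t ρ)) (sym (ᶜ-neg _))
  compile-correct false (t ⋆)   ρ = compile-correct true t ρ
  compile-correct true  (t ⋆)   ρ = trans (compile-correct false t ρ) (sym (ᶜ-invol _))

  _≐_ : ∀ {n} → Expr n → Expr n → Expr n × Expr n
  _≐_ = _,_

  normalForm : ∀ {n} → Expr n → Normal (n ℕ.+ n)
  normalForm t = normalise (compile false t)

  normalForm-correct : ∀ {n} (t : Expr n) ρ → ⟦ compile false t ⟧ₚ↓ (double ρ) ≈ ⟦ t ⟧ ρ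
  normalForm-correct t ρ = trans (correctₚ (compile false t) (double ρ)) (compile-correct false t ρ)

  module _ {n} (f : N-ary n (Expr n) (Expr n × Expr n)) where
    private
      sides = f $ⁿ Vec.map `_ (Vec.allFin n)
      lhs = proj₁ sides
      rhs = proj₂ sides

    prove : T (is-just (normalForm lhs ≟N normalForm rhs)) → ∀ ρ → ⟦ lhs ⟧ ρ ≈ ⟦ rhs ⟧ ρ
    prove t ρ with just eq ← normalForm lhs ≟N normalForm rhs = begin
      ⟦ lhs ⟧ ρ                            ≈⟨ normalForm-correct lhs ρ ⟨
      ⟦ compile false lhs ⟧ₚ↓ (double ρ)   ≈⟨ ⟦ eq ⟧N-cong (double ρ) ⟩
      ⟦ compile false rhs ⟧ₚ↓ (double ρ)   ≈⟨ normalForm-correct rhs ρ ⟩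
      ⟦ rhs ⟧ ρ                            ∎

  -- When the normal forms agree, the type of the implicit argument evaluates to `⊤` and is filled
  -- automatically; otherwise it is empty and the call is rejected.
  solve : ∀ n (f : N-ary n (Expr n) (Expr n × Expr n))
    {_ : T (is-just (normalForm (proj₁ (f $ⁿ Vec.map `_ (Vec.allFin n))) ≟N normalForm (proj₂ (f $ⁿ Vec.map `_ (Vec.allFin n)))))} →
    Eq n _≈_ (curryⁿ ⟦ proj₁ (f $ⁿ Vec.map `_ (Vec.allFin n)) ⟧) (curryⁿ ⟦ proj₂ (f $ⁿ Vec.map `_ (Vec.allFin n)) ⟧)
  solve n f {t} = curryⁿ-cong _≈_ _ _ (prove f t)

-- Identities and inequalities for a single column

module Units (S : PositiveStarRing) where
  open PositiveStarRing S
  open StarSolver S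
  open import Relation.Binary.Reasoning.Setoid setoid

  -- Works modulo the relation l ≈ r, with cofactor k.

  elim : ∀ {x y k l r} → l ≈ r → x ≈ y + k * (l - r) → x ≈ y
  elim {x} {y} {k} {l} {r} l≈r eq = begin
    x                ≈⟨ eq ⟩
    y + k * (l - r)  ≈⟨ +-congˡ (*-congˡ (+-congʳ l≈r)) ⟩
    y + k * (r - r)  ≈⟨ solve 3 (λ y k r → y ⊕ k ⊗ (r ⊖ r) ≐ y) y k r ⟩
    y                ∎

  -- Heron's formula for the triangle with side vectors x yᶜ, y zᶜ, z xᶜ.

  heron : ∀ x y z → x * y ᶜ + y * z ᶜ + z * x ᶜ ≈ ι (+ 0) →
    let A = x * x ᶜ ; B = y * y ᶜ ; C = z * z ᶜ ; σ₂ = A * B + B * C + C * A in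
    Pos (ι (+ 4) * (A * B * C) * (A + B + C) - σ₂ * σ₂)
  heron x y z eq = Pos-resp (sym lem) (Pos-sq κ)
    where
    ξ = x * y ᶜ
    η = y * z ᶜ
    ζ = z * x ᶜ
    -- Over the complex numbers this is 2i Im(ξη̄), so `κ * κ ᶜ` is sixteen times the squared area
    -- of the triangle with sides ξ, η, ζ.
    κ = ξ * η ᶜ - ξ ᶜ * η
    ζ≈ : ζ ≈ - (ξ + η)
    ζ≈ = elim eq (solve 3 (λ ξ η ζ → ζ ≐ ⊝ (ξ ⊕ η) ⊕ # (+ 1) ⊗ (ξ ⊕ η ⊕ ζ ⊖ # (+ 0))) ξ η ζ)
    lem : _ ≈ κ * κ ᶜ
    -- The closing of the triangle enters only through Z = Z′, that is ∣ζ∣² = ∣ξ + η∣²; the cofactor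
    -- comes from a difference of two squares.
    lem = elim (*-cong ζ≈ (ᶜ-cong ζ≈)) (solve 3 (λ x y z →
      let A = x ⊗ x ⋆ ; B = y ⊗ y ⋆ ; C = z ⊗ z ⋆ ; σ₂ = A ⊗ B ⊕ B ⊗ C ⊕ C ⊗ A
          ξ = x ⊗ y ⋆ ; η = y ⊗ z ⋆ ; ζ = z ⊗ x ⋆ ; κ = ξ ⊗ η ⋆ ⊖ ξ ⋆ ⊗ η
          Z = ζ ⊗ ζ ⋆ ; Z′ = (⊝ (ξ ⊕ η)) ⊗ (⊝ (ξ ⊕ η)) ⋆
      in # (+ 4) ⊗ (A ⊗ B ⊗ C) ⊗ (A ⊕ B ⊕ C) ⊖ σ₂ ⊗ σ₂ ≐
         κ ⊗ κ ⋆ ⊕ (# (+ 2) ⊗ (ξ ⊗ ξ ⋆ ⊕ η ⊗ η ⋆) ⊖ Z ⊖ Z′) ⊗ (Z ⊖ Z′)) x y z)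

  -- The parallelogram law removes the unimodular α. The factor 2 is kept because it later joins the
  -- 3 of `cyclic` to form the 6 that `cancel₆` removes.
  parallelogram : ∀ {X Y α} → α * α ᶜ ≈ ι (+ 1) → (X + α * Y) * (X + α * Y) ᶜ ≈ ι (+ 6) →
    (X + (- α) * Y) * (X + (- α) * Y) ᶜ ≈ ι (+ 6) → ι (+ 2) * (X * X ᶜ + Y * Y ᶜ) ≈ ι (+ 12)
  parallelogram {X} {Y} {α} αα h₁ h₂ = begin
    ι (+ 2) * (X * X ᶜ + Y * Y ᶜ) ≈⟨ elim αα (solve 3 (λ X Y α → # (+ 2) ⊗ (X ⊗ X ⋆ ⊕ Y ⊗ Y ⋆) ≐
         ((X ⊕ α ⊗ Y) ⊗ (X ⊕ α ⊗ Y) ⋆ ⊕ (X ⊕ (⊝ α) ⊗ Y) ⊗ (X ⊕ (⊝ α) ⊗ Y) ⋆)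
         ⊕ # -[1+ 1 ] ⊗ (Y ⊗ Y ⋆) ⊗ (α ⊗ α ⋆ ⊖ # (+ 1))) X Y α) ⟩
    _ ≈⟨ +-cong h₁ h₂ ⟩
    ι (+ 6) + ι (+ 6) ≈⟨ sym (ι-+ (+ 6) (+ 6)) ⟩
    ι (+ 12) ∎

  module _ (ω : Carrier) (ω+ωᶜ : ι (+ 1) + ω + ω ᶜ ≈ ι (+ 0)) (ωωᶜ : ω * ω ᶜ ≈ ι (+ 1)) where
    -- The discrete Fourier transform of (x, y, z), that is, its inner products with (1, 1, 1), (1,
    -- ω, ωᶜ) and (1, ωᶜ, ω).
    X₀ X₁ X₂ : Carrier → Carrier → Carrier → Carrier
    X₀ x y z = x + y + z
    X₁ x y z = x + ω ᶜ * y + ω * z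
    X₂ x y z = x + ω * y + ω ᶜ * z

    parseval : ∀ x y z → X₀ x y z * X₀ x y z ᶜ + X₁ x y z * X₁ x y z ᶜ + X₂ x y z * X₂ x y z ᶜ ≈
      ι (+ 3) * (x * x ᶜ + y * y ᶜ + z * z ᶜ)
    parseval x y z = elim ωωᶜ (elim ω+ωᶜ (solve 4 (λ x y z w →
      (x ⊕ y ⊕ z) ⊗ (x ⊕ y ⊕ z) ⋆ ⊕ (x ⊕ w ⋆ ⊗ y ⊕ w ⊗ z) ⊗ (x ⊕ w ⋆ ⊗ y ⊕ w ⊗ z) ⋆ ⊕
      (x ⊕ w ⊗ y ⊕ w ⋆ ⊗ z) ⊗ (x ⊕ w ⊗ y ⊕ w ⋆ ⊗ z) ⋆ ≐
      (# (+ 3) ⊗ (x ⊗ x ⋆ ⊕ y ⊗ y ⋆ ⊕ z ⊗ z ⋆) ⊕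
      (# (+ 2) ⊗ (y ⊗ y ⋆ ⊕ z ⊗ z ⋆) ⊖ # (+ 2) ⊗ (y ⊗ z ⋆ ⊕ z ⊗ y ⋆)) ⊗ (w ⊗ w ⋆ ⊖ # (+ 1))) ⊕
      (x ⊗ y ⋆ ⊕ x ⊗ z ⋆ ⊕ y ⊗ x ⋆ ⊕ z ⊗ x ⋆ ⊕ (w ⊕ w ⋆ ⊖ # (+ 1)) ⊗ (y ⊗ z ⋆ ⊕ z ⊗ y ⋆)) ⊗ (# (+ 1) ⊕ w ⊕ w ⋆ ⊖ # (+ 0)))
      x y z ω))

    -- Inverting the transform of the power spectrum gives the cyclic autocorrelation: `parseval` is
    -- the case of shift zero, this is shift one.
    cyclic : ∀ x y z → X₀ x y z * X₀ x y z ᶜ + ω ᶜ * (X₁ x y z * X₁ x y z ᶜ) + ω * (X₂ x y z * X₂ x y z ᶜ) ≈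
      ι (+ 3) * (x * y ᶜ + y * z ᶜ + z * x ᶜ)
    cyclic x y z = elim ωωᶜ (elim ω+ωᶜ (solve 4 (λ x y z w →
      (x ⊕ y ⊕ z) ⊗ (x ⊕ y ⊕ z) ⋆ ⊕ w ⋆ ⊗ ((x ⊕ w ⋆ ⊗ y ⊕ w ⊗ z) ⊗ (x ⊕ w ⋆ ⊗ y ⊕ w ⊗ z) ⋆) ⊕
      w ⊗ ((x ⊕ w ⊗ y ⊕ w ⋆ ⊗ z) ⊗ (x ⊕ w ⊗ y ⊕ w ⋆ ⊗ z) ⋆) ≐
      (# (+ 3) ⊗ (x ⊗ y ⋆ ⊕ y ⊗ z ⋆ ⊕ z ⊗ x ⋆) ⊕
      ((w ⊕ w ⋆) ⊗ (y ⊗ y ⋆ ⊕ z ⊗ z ⋆ ⊕ z ⊗ y ⋆) ⊕ # (+ 2) ⊗ (x ⊗ y ⋆ ⊕ z ⊗ x ⋆ ⊖ x ⊗ z ⋆ ⊖ y ⊗ x ⋆)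
        ⊖ (w ⊕ w ⋆ ⊖ # (+ 2)) ⊗ (y ⊗ z ⋆)) ⊗ (w ⊗ w ⋆ ⊖ # (+ 1))) ⊕
      (x ⊗ x ⋆ ⊕ y ⊗ y ⋆ ⊕ z ⊗ z ⋆ ⊕ z ⊗ y ⋆ ⊕ (w ⊕ w ⋆ ⊖ # (+ 1)) ⊗ (x ⊗ z ⋆ ⊕ y ⊗ x ⋆)
        ⊕ ((w ⊖ # (+ 1)) ⊗ w ⊕ (w ⋆ ⊖ # (+ 1)) ⊗ w ⋆) ⊗ (y ⊗ z ⋆)) ⊗ (# (+ 1) ⊕ w ⊕ w ⋆ ⊖ # (+ 0)))
      x y z ω))

    -- For a flat spectrum the left side of `cyclic` is a multiple of 1 + ω + ωᶜ.
    cyclic-vanishes : ∀ {x y z} → let X = X₀ x y z ; Y = X₁ x y z ; Z = X₂ x y z in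
      X * X ᶜ ≈ ι (+ 6) → Y * Y ᶜ ≈ ι (+ 6) → Z * Z ᶜ ≈ ι (+ 6) → x * y ᶜ + y * z ᶜ + z * x ᶜ ≈ ι (+ 0)
    cyclic-vanishes {x} {y} {z} X≈ Y≈ Z≈ = cancel₆ (begin
      ι (+ 6) * c                    ≈⟨ solve 1 (λ c → # (+ 6) ⊗ c ≐ # (+ 2) ⊗ (# (+ 3) ⊗ c)) c ⟩
      ι (+ 2) * (ι (+ 3) * c)        ≈⟨ *-congˡ (cyclic x y z) ⟨
      ι (+ 2) * (_ + ω ᶜ * _ + ω * _) ≈⟨ *-congˡ (+-cong (+-cong X≈ (*-congˡ Y≈)) (*-congˡ Z≈)) ⟩
      ι (+ 2) * (ι (+ 6) + ω ᶜ * ι (+ 6) + ω * ι (+ 6)) ≈⟨ elim ω+ωᶜ (solve 1 (λ w →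
         # (+ 2) ⊗ (# (+ 6) ⊕ w ⋆ ⊗ # (+ 6) ⊕ w ⊗ # (+ 6)) ≐ # (+ 0) ⊕ # (+ 12) ⊗ (# (+ 1) ⊕ w ⊕ w ⋆ ⊖ # (+ 0))) ω) ⟩
      ι (+ 0)                        ∎)
      where c = x * y ᶜ + y * z ᶜ + z * x ᶜ

    norms-sum : ∀ {x y z} → let X = X₀ x y z ; Y = X₁ x y z ; Z = X₂ x y z in
      X * X ᶜ ≈ ι (+ 6) → Y * Y ᶜ ≈ ι (+ 6) → Z * Z ᶜ ≈ ι (+ 6) → x * x ᶜ + y * y ᶜ + z * z ᶜ ≈ ι (+ 6)
    norms-sum {x} {y} {z} X≈ Y≈ Z≈ = elim (cancel₆ (begin
      ι (+ 6) * (N - ι (+ 6))                    ≈⟨ solve 1 (λ c → # (+ 6) ⊗ (c ⊖ # (+ 6)) ≐ # (+ 2) ⊗ (# (+ 3) ⊗ c) ⊖ # (+ 36)) N ⟩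
      ι (+ 2) * (ι (+ 3) * N) - ι (+ 36)        ≈⟨ +-congʳ (*-congˡ (parseval x y z)) ⟨
      ι (+ 2) * (_ + _ + _) - ι (+ 36) ≈⟨ +-congʳ (*-congˡ (+-cong (+-cong X≈ Y≈) Z≈)) ⟩
      ι (+ 2) * (ι (+ 6) + ι (+ 6) + ι (+ 6)) - ι (+ 36) ≈⟨ solve 0 (# (+ 2) ⊗ (# (+ 6) ⊕ # (+ 6) ⊕ # (+ 6)) ⊖ # (+ 36) ≐ # (+ 0)) ⟩
      ι (+ 0)                        ∎))
      (solve 1 (λ N → N ≐ # (+ 6) ⊕ # (+ 1) ⊗ (N ⊖ # (+ 6) ⊖ # (+ 0))) N)
      where N = x * x ᶜ + y * y ᶜ + z * z ᶜ

    -- With A + B + C = 6 the expression in `heron` becomes 24ABC - σ₂². The norms are passed as A,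
    -- B, C so that callers can supply them in simplified form.
    heron-bound : ∀ {x y z A B C} → let X = X₀ x y z ; Y = X₁ x y z ; Z = X₂ x y z in
      X * X ᶜ ≈ ι (+ 6) → Y * Y ᶜ ≈ ι (+ 6) → Z * Z ᶜ ≈ ι (+ 6) →
      x * x ᶜ ≈ A → y * y ᶜ ≈ B → z * z ᶜ ≈ C → let σ₂ = A * B + B * C + C * A in
      A + B + C ≈ ι (+ 6) × Pos (ι (+ 24) * (A * B * C) - σ₂ * σ₂)
    heron-bound {x} {y} {z} {A} {B} {C} X≈ Y≈ Z≈ A≈ B≈ C≈ = sum≈6 , Pos-resp bound (heron x y z (cyclic-vanishes X≈ Y≈ Z≈))
      where
      sum≈6 : A + B + C ≈ ι (+ 6)
      sum≈6 = trans (sym (+-cong (+-cong A≈ B≈) C≈)) (norms-sum X≈ Y≈ Z≈)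
      σ₂≈ = +-cong (+-cong (*-cong A≈ B≈) (*-cong B≈ C≈)) (*-cong C≈ A≈)
      bound : _ ≈ ι (+ 24) * (A * B * C) - (A * B + B * C + C * A) * (A * B + B * C + C * A)
      bound = trans
        (+-cong (*-cong (*-congˡ (*-cong (*-cong A≈ B≈) C≈)) (norms-sum X≈ Y≈ Z≈)) (-‿cong (*-cong σ₂≈ σ₂≈)))
        (solve 2 (λ π σ → # (+ 4) ⊗ π ⊗ # (+ 6) ⊖ σ ⊗ σ ≐ # (+ 24) ⊗ π ⊖ σ ⊗ σ) _ _)

    -- The spectra of the two triples add up to a flat one, so their autocorrelations cancel, by the
    -- same computation as in `cyclic-vanishes`.
    cyclic-opposite : ∀ {x y z x′ y′ z′} →
      let norms = λ (X : Carrier → Carrier → Carrier → Carrier) → X x y z * X x y z ᶜ + X x′ y′ z′ * X x′ y′ z′ ᶜ in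
      ι (+ 2) * norms X₀ ≈ ι (+ 12) → ι (+ 2) * norms X₁ ≈ ι (+ 12) → ι (+ 2) * norms X₂ ≈ ι (+ 12) →
      x′ * y′ ᶜ + y′ * z′ ᶜ + z′ * x′ ᶜ ≈ - (x * y ᶜ + y * z ᶜ + z * x ᶜ)
    cyclic-opposite {x} {y} {z} {x′} {y′} {z′} h₀ h₁ h₂ = elim (cancel₆ (begin
      ι (+ 6) * (c + c′) ≈⟨ solve 2 (λ c c′ → # (+ 6) ⊗ (c ⊕ c′) ≐ # (+ 2) ⊗ (# (+ 3) ⊗ c ⊕ # (+ 3) ⊗ c′)) c c′ ⟩
      ι (+ 2) * (ι (+ 3) * c + ι (+ 3) * c′) ≈⟨ *-congˡ (+-cong (cyclic x y z) (cyclic x′ y′ z′)) ⟨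
      _ ≈⟨ solve 8 (λ w x₀ x₁ x₂ y₀ y₁ y₂ t → # (+ 2) ⊗ (x₀ ⊕ w ⋆ ⊗ x₁ ⊕ w ⊗ x₂ ⊕ (y₀ ⊕ w ⋆ ⊗ y₁ ⊕ w ⊗ y₂)) ≐
             # (+ 2) ⊗ (x₀ ⊕ y₀) ⊕ w ⋆ ⊗ (# (+ 2) ⊗ (x₁ ⊕ y₁)) ⊕ w ⊗ (# (+ 2) ⊗ (x₂ ⊕ y₂))) ω _ _ _ _ _ _ 0# ⟩
      _ ≈⟨ +-cong (+-cong h₀ (*-congˡ h₁)) (*-congˡ h₂) ⟩
      ι (+ 12) + ω ᶜ * ι (+ 12) + ω * ι (+ 12) ≈⟨ elim ω+ωᶜ (solve 1 (λ w →
         # (+ 12) ⊕ w ⋆ ⊗ # (+ 12) ⊕ w ⊗ # (+ 12) ≐ # (+ 0) ⊕ # (+ 12) ⊗ (# (+ 1) ⊕ w ⊕ w ⋆ ⊖ # (+ 0))) ω) ⟩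
      ι (+ 0) ∎))
      (solve 2 (λ c c′ → c′ ≐ ⊝ c ⊕ # (+ 1) ⊗ (c ⊕ c′ ⊖ # (+ 0))) c c′)
      where
      c = x * y ᶜ + y * z ᶜ + z * x ᶜ
      c′ = x′ * y′ ᶜ + y′ * z′ ᶜ + z′ * x′ ᶜ

  Unit : Carrier → Set
  Unit x = x * x ᶜ ≈ ι (+ 1)

  -- The three terms p, q, r of c are unimodular with product 1, so pq + qr + rp = cᶜ, and Newton's
  -- identity gives p³ + q³ + r³ = c³ - 3ccᶜ + 3. The left side is 3 plus this sum and its
  -- conjugate.
  cubes : ∀ {x y z} → Unit x → Unit y → Unit z →
    let c = x * y ᶜ + y * z ᶜ + z * x ᶜ ; s = x * x * x + y * y * y + z * z * z in
    s * s ᶜ ≈ ι (+ 9) + c * c * c + (c * c * c) ᶜ - ι (+ 6) * (c * c ᶜ)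
  cubes {x} {y} {z} ux uy uz = elim uz (elim uy (elim ux (solve 3 (λ x y z →
    let c = x ⊗ y ⋆ ⊕ y ⊗ z ⋆ ⊕ z ⊗ x ⋆ ; s = x ⊗ x ⊗ x ⊕ y ⊗ y ⊗ y ⊕ z ⊗ z ⊗ z
        A = x ⊗ x ⋆ ; B = y ⊗ y ⋆ ; C = z ⊗ z ⋆
        real = λ t → # (+ 3) ⊗ (c ⊗ t ⊕ c ⋆ ⊗ t ⋆)
    in s ⊗ s ⋆ ≐ # (+ 9) ⊕ c ⊗ c ⊗ c ⊕ (c ⊗ c ⊗ c) ⋆ ⊖ # (+ 6) ⊗ (c ⊗ c ⋆)
      ⊕ (C ⊗ C ⊕ C ⊕ # (+ 1) ⊕ # (+ 6) ⊗ A ⊗ B ⊖ real (y ⊗ x ⋆)) ⊗ (C ⊖ # (+ 1))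
      ⊕ (B ⊗ B ⊕ B ⊕ # (+ 1) ⊕ # (+ 6) ⊗ A ⊖ real (x ⊗ z ⋆)) ⊗ (B ⊖ # (+ 1))
      ⊕ (A ⊗ A ⊕ A ⊕ # (+ 7) ⊖ real (z ⊗ y ⋆)) ⊗ (A ⊖ # (+ 1))) x y z)))

  -- Replacing c by -c changes the sign of the cubic terms in `cubes`; adding the two squared moduli
  -- cancels them and doubles the rest.
  cyclic-bound : ∀ {x y z x′ y′ z′} → Unit x → Unit y → Unit z → Unit x′ → Unit y′ → Unit z′ →
    let c = x * y ᶜ + y * z ᶜ + z * x ᶜ in
    x′ * y′ ᶜ + y′ * z′ ᶜ + z′ * x′ ᶜ ≈ - c → Pos (ι (+ 18) - ι (+ 12) * (c * c ᶜ))
  cyclic-bound {x} {y} {z} {x′} {y′} {z′} ux uy uz ux′ uy′ uz′ c′≈ =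
    Pos-resp (begin
      _ ≈⟨ +-cong (cubes ux uy uz) (cubes ux′ uy′ uz′) ⟩
      _ ≈⟨ +-congˡ (+-cong (+-cong (+-congˡ c³≈) (ᶜ-cong c³≈)) (-‿cong (*-congˡ (*-cong c′≈ (ᶜ-cong c′≈))))) ⟩
      _ ≈⟨ solve 1 (λ c → let g = λ c → # (+ 9) ⊕ c ⊗ c ⊗ c ⊕ (c ⊗ c ⊗ c) ⋆ ⊖ # (+ 6) ⊗ (c ⊗ c ⋆) in
             g c ⊕ g (⊝ c) ≐ # (+ 18) ⊖ # (+ 12) ⊗ (c ⊗ c ⋆)) c ⟩
      _ ∎)
      (Pos-+ (Pos-sq (x * x * x + y * y * y + z * z * z)) (Pos-sq (x′ * x′ * x′ + y′ * y′ * y′ + z′ * z′ * z′)))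
    where
    c = x * y ᶜ + y * z ᶜ + z * x ᶜ
    c³≈ = *-cong (*-cong c′≈ c′≈) c′≈

  -- With E = PQ + QR + RP and P + Q + R = 0, the two Heron expressions are 48 + 24E ± 24PQR - E².
  -- Their sum loses PQR, and two copies of EEᶜ cancel -2E². Writing P as p + pᶜ shows the solver
  -- that E is self-conjugate.
  e₂-bound : ∀ p q r → let P = p + p ᶜ ; Q = q + q ᶜ ; R = r + r ᶜ
                           h = λ A B C → ι (+ 24) * (A * B * C) - (A * B + B * C + C * A) * (A * B + B * C + C * A) in
    P + Q + R ≈ ι (+ 0) →
    Pos (h (ι (+ 2) + P) (ι (+ 2) + Q) (ι (+ 2) + R)) →
    Pos (h (ι (+ 2) - P) (ι (+ 2) - Q) (ι (+ 2) - R)) →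
    Pos (ι (+ 96) + ι (+ 48) * (P * Q + Q * R + R * P))
  e₂-bound p q r S≈0 pos⁺ pos⁻ = Pos-resp (elim S≈0 (solve 3 (λ p q r →
      let P = p ⊕ p ⋆ ; Q = q ⊕ q ⋆ ; R = r ⊕ r ⋆ ; S = P ⊕ Q ⊕ R ; E = P ⊗ Q ⊕ Q ⊗ R ⊕ R ⊗ P
          h = λ A B C → # (+ 24) ⊗ (A ⊗ B ⊗ C) ⊖ (A ⊗ B ⊕ B ⊗ C ⊕ C ⊗ A) ⊗ (A ⊗ B ⊕ B ⊗ C ⊕ C ⊗ A)
      in h (# (+ 2) ⊕ P) (# (+ 2) ⊕ Q) (# (+ 2) ⊕ R) ⊕ h (# (+ 2) ⊖ P) (# (+ 2) ⊖ Q) (# (+ 2) ⊖ R)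
         ⊕ (E ⊗ E ⋆ ⊕ E ⊗ E ⋆)
         ≐ # (+ 96) ⊕ # (+ 48) ⊗ E ⊕ # -[1+ 31 ] ⊗ S ⊗ (S ⊖ # (+ 0))) p q r))
    (Pos-+ (Pos-+ pos⁺ pos⁻) (Pos-+ (Pos-sq _) (Pos-sq _)))

-- Moments of a full system

Index : List ℕ → Set
Index []       = ⊤
Index (n ∷ ns) = Fin n × Index ns

-- A counterpart of the ring-valued sum that the type checker can evaluate.
∑ℕ : ∀ ns → (Index ns → ℕ) → ℕ
∑ℕ []       f = f tt
∑ℕ (n ∷ ns) f = SemiringSum.sum ℕ.+-*-semiring (λ i → ∑ℕ ns (λ is → f (i , is)))

-- Iterated finite sums, positivity, and fourth powers of inner products

module MultiSum (S : PositiveStarRing) where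
  open PositiveStarRing S
  open StarSolver S
  open SemiringSum semiring using (sum; sum-cong-≋; sum-remove; ∑-distrib-+; ∑-comm; *-distribˡ-sum) public
  open import Relation.Binary.Reasoning.Setoid setoid

  Pos-ι : ∀ n → Pos (ι (+ n))
  Pos-ι zero    = Pos-resp (trans (*-congʳ ι-0) (trans (zeroˡ _) (sym ι-0))) (Pos-sq (ι (+ 0)))
  Pos-ι (suc n) = Pos-resp (sym (ι-+ (+ 1) (+ n))) (Pos-+ (Pos-resp
    (trans (*-cong ι-1 (trans (ᶜ-ι (+ 1)) ι-1)) (trans (*-identityˡ 1#) (sym ι-1))) (Pos-sq (ι (+ 1)))) (Pos-ι n))

  ¬Pos-ι : ∀ n → ¬ Pos (ι -[1+ n ])
  ¬Pos-ι n p = ¬Pos-neg (Pos-resp (trans (sym (ι-+ -[1+ n ] (+ n))) (reflexive (≡.cong ι (n⊖[1+n] n)))) (Pos-+ p (Pos-ι n)))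
    where
    n⊖[1+n] : ∀ n → n ℤ.⊖ suc n ≡ -[1+ 0 ]
    n⊖[1+n] zero    = ≡.refl
    n⊖[1+n] (suc n) = ≡.trans (ℤ.[1+m]⊖[1+n]≡m⊖n n (suc n)) (n⊖[1+n] n)

  sum-ᶜ : ∀ {n} (f : Vector Carrier n) → sum f ᶜ ≈ sum (λ i → f i ᶜ)
  sum-ᶜ {zero}  f = trans (ᶜ-cong (sym ι-0)) (trans (ᶜ-ι (+ 0)) ι-0)
  sum-ᶜ {suc n} f = trans (ᶜ-+ _ _) (+-congˡ (sum-ᶜ (λ i → f (suc i))))

  opaque
    -- Opaque, so that sums over 36 columns or 1296 quadruples are never expanded.
    ∑ : ∀ ns → (Index ns → Carrier) → Carrier
    ∑ []       f = f tt
    ∑ (n ∷ ns) f = sum (λ i → ∑ ns (λ is → f (i , is)))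

  sum-ι : ∀ {n} (f : Vector ℕ n) → sum (λ i → ι (+ f i)) ≈ ι (+ SemiringSum.sum ℕ.+-*-semiring f)
  sum-ι {zero}  f = sym ι-0
  sum-ι {suc n} f = trans (+-congˡ (sum-ι (λ i → f (suc i)))) (sym (ι-+ _ _))

  Pos-0 : Pos 0#
  Pos-0 = Pos-resp ι-0 (Pos-ι 0)

  Pos-sum : ∀ {n} {f : Vector Carrier n} → (∀ i → Pos (f i)) → Pos (sum f)
  Pos-sum {zero}  p = Pos-0
  Pos-sum {suc n} p = Pos-+ (p zero) (Pos-sum (λ i → p (suc i)))

  Pos-ι* : ∀ n {x} → Pos x → Pos (ι (+ n) * x)
  Pos-ι* zero    {x} p = Pos-resp (sym (trans (*-congʳ ι-0) (zeroˡ x))) Pos-0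
  Pos-ι* (suc n) {x} p = Pos-resp
    (sym (trans (*-congʳ (trans (ι-+ (+ 1) (+ n)) (+-congʳ ι-1))) (trans (distribʳ x _ _) (+-congʳ (*-identityˡ x)))))
    (Pos-+ p (Pos-ι* n p))

  opaque
    unfolding ∑

    ∑-cong : ∀ ns {f g} → (∀ i → f i ≈ g i) → ∑ ns f ≈ ∑ ns g
    ∑-cong []       eq = eq tt
    ∑-cong (n ∷ ns) eq = sum-cong-≋ {n} (λ i → ∑-cong ns (λ is → eq (i , is)))

    ∑-+ : ∀ ns f g → ∑ ns (λ i → f i + g i) ≈ ∑ ns f + ∑ ns g
    ∑-+ []       f g = refl
    ∑-+ (n ∷ ns) f g = trans (sum-cong-≋ {n} (λ i → ∑-+ ns (λ is → f (i , is)) (λ is → g (i , is)))) (∑-distrib-+ {n} _ _)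

    ∑-ᶜ : ∀ ns f → ∑ ns f ᶜ ≈ ∑ ns (λ i → f i ᶜ)
    ∑-ᶜ []       f = refl
    ∑-ᶜ (n ∷ ns) f = trans (sum-ᶜ {n} _) (sum-cong-≋ {n} (λ i → ∑-ᶜ ns (λ is → f (i , is))))

    *-∑ : ∀ ns x f → x * ∑ ns f ≈ ∑ ns (λ i → x * f i)
    *-∑ []       x f = refl
    *-∑ (n ∷ ns) x f = trans (*-distribˡ-sum {n} x _) (sum-cong-≋ {n} (λ i → *-∑ ns x (λ is → f (i , is))))

    ∑-* : ∀ ns f x → ∑ ns f * x ≈ ∑ ns (λ i → f i * x)
    ∑-* ns f x = trans (*-comm _ _) (trans (*-∑ ns x f) (∑-cong ns (λ _ → *-comm _ _)))

    ∑-*-∑ : ∀ ms ns (f : Index ms → Carrier) (g : Index ns → Carrier) → ∑ ms f * ∑ ns g ≈ ∑ ms (λ i → ∑ ns (λ j → f i * g j))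
    ∑-*-∑ ms ns f g = trans (∑-* ms f _) (∑-cong ms (λ i → *-∑ ns (f i) g))

    ∑-sum-comm : ∀ ns {m} (f : Index ns → Fin m → Carrier) →
      ∑ ns (λ i → sum (f i)) ≈ sum (λ j → ∑ ns (λ i → f i j))
    ∑-sum-comm []       f = refl
    ∑-sum-comm (n ∷ ns) {m} f = trans (sum-cong-≋ {n} (λ i → ∑-sum-comm ns {m} (λ is → f (i , is)))) (∑-comm {n} {m} _)

    ∑-swap : ∀ ms ns (f : Index ms → Index ns → Carrier) → ∑ ms (λ i → ∑ ns (λ j → f i j)) ≈ ∑ ns (λ j → ∑ ms (λ i → f i j))
    ∑-swap ms []       f = refl
    ∑-swap ms (n ∷ ns) f = trans (∑-sum-comm ms {n} _) (sum-cong-≋ {n} (λ j → ∑-swap ms ns (λ i js → f i (j , js))))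

    ∑-ι : ∀ ns f → ∑ ns (λ i → ι (+ f i)) ≈ ι (+ ∑ℕ ns f)
    ∑-ι []       f = refl
    ∑-ι (n ∷ ns) f = trans (sum-cong-≋ {n} (λ i → ∑-ι ns (λ is → f (i , is)))) (sum-ι {n} (λ i → ∑ℕ ns (λ is → f (i , is))))

    Pos-∑ : ∀ ns {f} → (∀ i → Pos (f i)) → Pos (∑ ns f)
    Pos-∑ []       p = p tt
    Pos-∑ (n ∷ ns) p = Pos-sum (λ i → Pos-∑ ns (λ is → p (i , is)))

    -- Meant for a sum known to be zero: every term of it is then also nonpositive.
    Pos-∑-term : ∀ ns {f} → (∀ i → Pos (f i)) → ∀ i → Pos (∑ ns f - f i)
    Pos-∑-term []       p i = Pos-resp (sym (-‿inverseʳ _)) Pos-0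
    Pos-∑-term (suc n ∷ ns) {f} p (i , is) = Pos-resp
      (trans (solve 3 (λ a b c → a ⊖ b ⊕ c ≐ a ⊕ c ⊖ b) (F i) (f (i , is)) _)
        (+-congʳ (sym (sum-remove {i = i} F))))
      (Pos-+ (Pos-∑-term ns (λ is → p (i , is)) is) (Pos-sum (λ j → Pos-∑ ns (λ is → p (punchIn i j , is)))))
      where
      F : Vector Carrier (suc n)
      F = λ i → ∑ ns (λ is → f (i , is))
    Pos-∑-term (zero ∷ ns) p (() , _)

    ∑-head : ∀ n ns f → ∑ (suc n ∷ ns) f ≈ ∑ ns (λ is → f (zero , is)) + ∑ (n ∷ ns) (λ (i , is) → f (suc i , is))
    ∑-head n ns f = refl

    ∑-flatten : ∀ n ns (f : Index (n ∷ []) → Index ns → Carrier) → ∑ (n ∷ []) (λ i → ∑ ns (f i)) ≈ ∑ (n ∷ ns) (λ (i , is) → f (i , tt) is)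
    ∑-flatten n ns f = refl

    ∑-single : ∀ n (f : Vector Carrier n) → ∑ (n ∷ []) (λ (i , _) → f i) ≈ sum f
    ∑-single n f = refl

  ⟪_,_⟫ : ∀ {n} → Vector Carrier n → Vector Carrier n → Carrier
  ⟪ u , v ⟫ = sum (λ i → u i ᶜ * v i)

  -- The coordinates of the tensor u ⊗ u ⊗ ū ⊗ ū.
  monomial : ∀ {n} → Vector Carrier n → Index (n ∷ n ∷ n ∷ n ∷ []) → Carrier
  monomial u (a , b , c , d , _) = u a * u b * (u c ᶜ * u d ᶜ)

  -- The inner product of two fourfold tensors is the product of the four factorwise inner products,
  -- two of which are conjugated; the result is ∣⟨u, v⟩∣⁴.
  ∑-monomial : ∀ {n} (u v : Vector Carrier n) → let N = ⟪ u , v ⟫ * ⟪ u , v ⟫ ᶜ in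
    ∑ (n ∷ n ∷ n ∷ n ∷ []) (λ i → monomial u i * monomial v i ᶜ) ≈ N * N
  ∑-monomial {n} u v = sym (begin
    G * G ᶜ * (G * G ᶜ) ≈⟨ solve 1 (λ G → G ⊗ G ⋆ ⊗ (G ⊗ G ⋆) ≐ G ⋆ ⊗ (G ⋆ ⊗ (G ⊗ G))) G ⟩
    G ᶜ * (G ᶜ * (G * G)) ≈⟨ *-cong G′ (*-cong G′ (*-cong G≈ G≈)) ⟩
    ∑ [n] g′ * (∑ [n] g′ * (∑ [n] h′ * ∑ [n] h′)) ≈⟨ *-congˡ (*-congˡ (∑-*-∑ [n] [n] h′ h′)) ⟩
    ∑ [n] g′ * (∑ [n] g′ * ∑ [n] (λ (c , _) → ∑ [n] (λ (d , _) → h c * h d)))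
      ≈⟨ *-congˡ (*-congˡ (flatten (λ (c , _) (d , _) → h c * h d))) ⟩
    ∑ [n] g′ * (∑ [n] g′ * ∑ [nn] (λ (c , d , _) → h c * h d)) ≈⟨ *-congˡ (trans (∑-*-∑ [n] [nn] g′ _) (flatten _)) ⟩
    ∑ [n] g′ * ∑ (n ∷ n ∷ n ∷ []) (λ (b , c , d , _) → g b * (h c * h d)) ≈⟨ trans (∑-*-∑ [n] (n ∷ n ∷ n ∷ []) g′ _) (flatten _) ⟩
    ∑ (n ∷ n ∷ n ∷ n ∷ []) (λ (a , b , c , d , _) → g a * (g b * (h c * h d)))
      ≈⟨ ∑-cong (n ∷ n ∷ n ∷ n ∷ []) (λ (a , b , c , d , _) →
        solve 8 (λ ua ub uc ud va vb vc vd →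
          (ua ⊗ va ⋆) ⊗ ((ub ⊗ vb ⋆) ⊗ ((uc ⋆ ⊗ vc) ⊗ (ud ⋆ ⊗ vd))) ≐
          ua ⊗ ub ⊗ (uc ⋆ ⊗ ud ⋆) ⊗ (va ⊗ vb ⊗ (vc ⋆ ⊗ vd ⋆)) ⋆)
          (u a) (u b) (u c) (u d) (v a) (v b) (v c) (v d)) ⟩
    _ ∎)
    where
    G = ⟪ u , v ⟫
    [n] [nn] : List ℕ
    [n] = n ∷ []
    [nn] = n ∷ n ∷ []
    g h : Vector Carrier n
    g i = u i * v i ᶜ
    h i = u i ᶜ * v i
    g′ h′ : Index [n] → Carrier
    g′ (i , _) = g i
    h′ (i , _) = h i
    flatten : ∀ {ns} (f : Index [n] → Index ns → Carrier) →
      ∑ [n] (λ i → ∑ ns (λ is → f i is)) ≈ ∑ (n ∷ ns) (λ (i , is) → f (i , tt) is)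
    flatten f = ∑-flatten n _ f
    G≈ : G ≈ ∑ [n] h′
    G≈ = sym (∑-single n h)
    G′ : G ᶜ ≈ ∑ [n] g′
    G′ = trans (sum-ᶜ h) (trans
      (sum-cong-≋ (λ i → solve 2 (λ u v → (u ⋆ ⊗ v) ⋆ ≐ u ⊗ v ⋆) (u i) (v i)))
      (sym (∑-single n g)))

  ∑-norm : ∀ ns (f : Index ns → Carrier) → ∑ ns f * ∑ ns f ᶜ ≈ ∑ ns (λ x → ∑ ns (λ y → f x * f y ᶜ))
  ∑-norm ns f = trans (*-congˡ (∑-ᶜ ns f)) (∑-*-∑ ns ns f _)

[6,6] [6,6,6,6] : List ℕ
[6,6]     = 6 ∷ 6 ∷ []
[6,6,6,6] = 6 ∷ 6 ∷ 6 ∷ 6 ∷ []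

-- The expected ∣⟨u, v⟩∣² for two columns of a full system, each addressed by its matrix and its
-- position there.
gramNorm : Index [6,6] → Index [6,6] → ℕ
gramNorm (j , k , _) (j′ , k′ , _) =
  if does (j ≟ j′) then (if does (k ≟ k′) then 36 else 0) else 6

-- Equality of {a, b} and {c, d} as multisets, which makes the monomial 1 on every unimodular
-- vector.
balanced : Index [6,6,6,6] → Bool
balanced (a , b , c , d , _) =
  does (a ≟ c) ∧ does (b ≟ d) ∨ does (a ≟ d) ∧ does (b ≟ c)

designNorm : Index [6,6,6,6] → ℕ
designNorm i = if balanced i then 1296 else 0

-- Each of the 36 columns contributes 36² from itself and 6² from each of the 30 columns of the
-- other matrices.
∑-gramNorm² : ∑ℕ [6,6] (λ x → ∑ℕ [6,6] (λ y → gramNorm x y ℕ.* gramNorm x y)) ≡ 85536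
∑-gramNorm² = ≡.refl

-- There are 6 + 2 · 30 = 66 balanced quadruples, each worth 36². The agreement with the preceding
-- total is equality in the Welch bound.
∑-designNorm : ∑ℕ [6,6,6,6] designNorm ≡ 85536
∑-designNorm = ≡.refl

-- A full system is a projective 2-design

module Design (S : PositiveStarRing) where
  open PositiveStarRing S
  open StarSolver S
  open Units S
  open MultiSum S
  open import Relation.Binary.Reasoning.Setoid setoid

  -- `H j k` is column k of matrix j. All moduli appear squared, which keeps square roots out of the
  -- abstract ring.
  record System (H : Fin 6 → Fin 6 → Vector Carrier 6) : Set where
    field
      unit       : ∀ j k i → Unit (H j k i)
      orthogonal : ∀ j {k k′} → k ≢ k′ → ⟪ H j k , H j k′ ⟫ ≈ ι (+ 0)
      unbiased   : ∀ {j j′} → j ≢ j′ → ∀ k k′ → ⟪ H j k , H j′ k′ ⟫ * ⟪ H j k , H j′ k′ ⟫ ᶜ ≈ ι (+ 6)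

  self-product : ∀ (u : Vector Carrier 6) → (∀ i → Unit (u i)) → ⟪ u , u ⟫ ≈ ι (+ 6)
  self-product u unit = trans (sum-cong-≋ {6} (λ i → trans (*-comm _ _) (unit i))) (sum-ι {6} (λ _ → 1))

  module _ {H : Fin 6 → Fin 6 → Vector Carrier 6} (sys : System H) where
    open System sys

    vec : Index [6,6] → Vector Carrier 6
    vec (j , k , _) = H j k

    gramNorm-correct : ∀ x y → ⟪ vec x , vec y ⟫ * ⟪ vec x , vec y ⟫ ᶜ ≈ ι (+ gramNorm x y)
    gramNorm-correct (j , k , _) (j′ , k′ , _) with j ≟ j′
    ... | no  j≢j′   = unbiased j≢j′ k k′
    ... | yes ≡.refl with k ≟ k′
    ...   | yes ≡.refl = let eq = self-product (H j k) (unit j k) in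
      trans (*-cong eq (ᶜ-cong eq)) (solve 0 (# (+ 6) ⊗ (# (+ 6)) ⋆ ≐ # (+ 36)))
    ...   | no  k≢k′   = let eq = orthogonal j k≢k′ in
      trans (*-cong eq (ᶜ-cong eq)) (solve 0 (# (+ 0) ⊗ (# (+ 0)) ⋆ ≐ # (+ 0)))

    moment : Index [6,6,6,6] → Carrier
    moment i = ∑ [6,6] (λ x → monomial (vec x) i)

    -- Each squared modulus expands into a double sum over columns; summing over the quadruples
    -- first leaves ∣⟨u, v⟩∣⁴ for each pair of columns.
    ∑-moment : ∑ [6,6,6,6] (λ i → moment i * moment i ᶜ) ≈ ι (+ 85536)
    ∑-moment = begin
      ∑ [6,6,6,6] (λ i → moment i * moment i ᶜ)
        ≈⟨ ∑-cong [6,6,6,6] (λ i → ∑-norm [6,6] (λ x → monomial (vec x) i)) ⟩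
      ∑ [6,6,6,6] (λ i → ∑ [6,6] (λ x → ∑ [6,6] (λ y → monomial (vec x) i * monomial (vec y) i ᶜ)))
        ≈⟨ ∑-swap [6,6,6,6] [6,6] (λ i x → ∑ [6,6] (λ y → monomial (vec x) i * monomial (vec y) i ᶜ)) ⟩
      ∑ [6,6] (λ x → ∑ [6,6,6,6] (λ i → ∑ [6,6] (λ y → monomial (vec x) i * monomial (vec y) i ᶜ)))
        ≈⟨ ∑-cong [6,6] (λ x → ∑-swap [6,6,6,6] [6,6] (λ i y → monomial (vec x) i * monomial (vec y) i ᶜ)) ⟩
      ∑ [6,6] (λ x → ∑ [6,6] (λ y → ∑ [6,6,6,6] (λ i → monomial (vec x) i * monomial (vec y) i ᶜ)))
        ≈⟨ ∑-cong [6,6] (λ x → ∑-cong [6,6] (λ y → trans (∑-monomial (vec x) (vec y))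
             (trans (*-cong (gramNorm-correct x y) (gramNorm-correct x y)) (ι-*-ι (gramNorm x y))))) ⟩
      ∑ [6,6] (λ x → ∑ [6,6] (λ y → ι (+ (gramNorm x y ℕ.* gramNorm x y))))
        ≈⟨ ∑-cong [6,6] (λ x → ∑-ι [6,6] _) ⟩
      ∑ [6,6] (λ x → ι (+ ∑ℕ [6,6] (λ y → gramNorm x y ℕ.* gramNorm x y)))
        ≈⟨ ∑-ι [6,6] _ ⟩
      ι (+ ∑ℕ [6,6] (λ x → ∑ℕ [6,6] (λ y → gramNorm x y ℕ.* gramNorm x y)))
        ≡⟨ ≡.cong (λ n → ι (+ n)) ∑-gramNorm² ⟩
      ι (+ 85536) ∎
      where
      ι-*-ι : ∀ n → ι (+ n) * ι (+ n) ≈ ι (+ (n ℕ.* n))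
      ι-*-ι n = trans (sym (ι-* (+ n) (+ n))) (reflexive (≡.cong ι (≡.sym (ℤ.pos-* n n))))

    moment-excess : Index [6,6,6,6] → Carrier
    moment-excess i = moment i * moment i ᶜ - ι (+ designNorm i)

    ∑-moment-excess : ∑ [6,6,6,6] moment-excess ≈ 0#
    ∑-moment-excess = begin
      ∑ [6,6,6,6] moment-excess ≈⟨ ∑-+ [6,6,6,6] _ _ ⟩
      ∑ [6,6,6,6] (λ i → moment i * moment i ᶜ) + ∑ [6,6,6,6] (λ i → - ι (+ designNorm i))
        ≈⟨ +-cong ∑-moment (∑-cong [6,6,6,6] (λ i → solve 1 (λ t → ⊝ t ≐ # -[1+ 0 ] ⊗ t) _)) ⟩
      ι (+ 85536) + ∑ [6,6,6,6] (λ i → ι -[1+ 0 ] * ι (+ designNorm i))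
        ≈⟨ +-congˡ (trans (sym (*-∑ [6,6,6,6] (ι -[1+ 0 ]) _)) (*-congˡ (∑-ι [6,6,6,6] designNorm))) ⟩
      ι (+ 85536) + ι -[1+ 0 ] * ι (+ ∑ℕ [6,6,6,6] designNorm)
        ≡⟨ ≡.cong (λ n → ι (+ 85536) + ι -[1+ 0 ] * ι (+ n)) ∑-designNorm ⟩
      ι (+ 85536) + ι -[1+ 0 ] * ι (+ 85536)
        ≈⟨ solve 0 (# (+ 85536) ⊕ # -[1+ 0 ] ⊗ # (+ 85536) ≐ # (+ 0)) ⟩
      ι (+ 0) ≈⟨ ι-0 ⟩
      0# ∎

    monomial-balanced : ∀ {u : Vector Carrier 6} → (∀ i → Unit (u i)) → ∀ a b → u a * u b * (u a ᶜ * u b ᶜ) ≈ ι (+ 1)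
    monomial-balanced {u} unit a b = begin
      u a * u b * (u a ᶜ * u b ᶜ) ≈⟨ solve 2 (λ x y → x ⊗ y ⊗ (x ⋆ ⊗ y ⋆) ≐ x ⊗ x ⋆ ⊗ (y ⊗ y ⋆)) (u a) (u b) ⟩
      u a * u a ᶜ * (u b * u b ᶜ) ≈⟨ *-cong (unit a) (unit b) ⟩
      ι (+ 1) * ι (+ 1)           ≈⟨ ι-* (+ 1) (+ 1) ⟨
      ι (+ 1)                     ∎

    moment-const : ∀ {i} → (∀ x → monomial (vec x) i ≈ ι (+ 1)) → Pos (moment i * moment i ᶜ - ι (+ 1296))
    moment-const {i} eq = Pos-resp (begin
      ι (+ 0) ≈⟨ solve 0 (# (+ 36) ⊗ (# (+ 36)) ⋆ ⊖ # (+ 1296) ≐ # (+ 0)) ⟨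
      ι (+ 36) * ι (+ 36) ᶜ - ι (+ 1296) ≈⟨ +-congʳ (*-cong m (ᶜ-cong m)) ⟨
      moment i * moment i ᶜ - ι (+ 1296) ∎) (Pos-ι 0)
      where
      m : moment i ≈ ι (+ 36)
      m = trans (∑-cong [6,6] eq) (∑-ι [6,6] (λ _ → 1))

    moment-square : ∀ i → Pos (moment i * moment i ᶜ - ι (+ 0))
    moment-square i = Pos-resp (solve 1 (λ t → t ≐ t ⊖ # (+ 0)) _) (Pos-sq (moment i))

    -- For balanced quadruples the moment is 36 and the excess is zero; for all others the excess is
    -- a squared modulus.
    moment-excess-Pos : ∀ i → Pos (moment-excess i)
    moment-excess-Pos i@(a , b , c , d , _) with a ≟ c | b ≟ d | a ≟ d | b ≟ c
    ... | yes ≡.refl | yes ≡.refl | _          | _          = moment-const {i} (λ (j , k , _) → monomial-balanced (unit j k) a b)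
    -- These decisions contradict each other, but `balanced` evaluates to true on them, so the case
    -- closes like the other balanced ones.
    ... | yes ≡.refl | no _       | yes ≡.refl | yes ≡.refl = moment-const {i} (λ (j , k , _) → monomial-balanced (unit j k) a b)
    ... | no _       | _          | yes ≡.refl | yes ≡.refl = moment-const {i} (λ (j , k , _) →
      trans (*-congˡ (*-comm _ _)) (monomial-balanced (unit j k) a b))
    ... | yes _      | no _       | no _       | _          = moment-square i
    ... | yes _      | no _       | yes _      | no _       = moment-square i
    ... | no _       | _          | no _       | _          = moment-square i
    ... | no _       | _          | yes _      | no _       = moment-square i

    -- The excesses are nonnegative with sum zero. The vanishing of the moment is expressed by a
    -- sign, since the axioms for `Pos` offer no passage from there to `moment i ≈ 0#`.
    unbalanced-moment : ∀ i → balanced i ≡ false → Pos (- (moment i * moment i ᶜ))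
    unbalanced-moment i eq = Pos-resp (begin
      ∑ [6,6,6,6] moment-excess - moment-excess i ≈⟨ +-congʳ ∑-moment-excess ⟩
      0# - moment-excess i ≈⟨ +-identityˡ _ ⟩
      - moment-excess i ≡⟨ ≡.cong (λ b → - (moment i * moment i ᶜ - ι (+ (if b then 1296 else 0)))) eq ⟩
      - (moment i * moment i ᶜ - ι (+ 0)) ≈⟨ solve 1 (λ t → ⊝ (t ⊖ # (+ 0)) ≐ ⊝ t) _ ⟩
      - (moment i * moment i ᶜ) ∎)
      (Pos-∑-term [6,6,6,6] moment-excess-Pos i)

-- The two Fourier families

module Core (S : PositiveStarRing) where
  open PositiveStarRing S
  open StarSolver S
  open Units S
  open MultiSum S
  open Design S
  open import Relation.Binary.Reasoning.Setoid setoid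

  [5,6] : List ℕ
  [5,6] = 5 ∷ 6 ∷ []

  -- Moments of the thirty columns outside the first matrix

  module Rest {H : Fin 6 → Fin 6 → Vector Carrier 6} (sys : System H) where
    open System sys

    rest : Index [5,6] → Vector Carrier 6
    rest (j , k , _) = H (suc j) k

    twiceRe : Carrier → Carrier
    twiceRe x = x + x ᶜ

    restMoment : Index [6,6,6,6] → Carrier
    restMoment i = ∑ [5,6] (λ x → monomial (rest x) i)

    ∑-twiceRe : ∀ i → ∑ [5,6] (λ x → twiceRe (monomial (rest x) i)) ≈ twiceRe (restMoment i)
    ∑-twiceRe i = trans (∑-+ [5,6] _ _) (+-congˡ (sym (∑-ᶜ [5,6] _)))

    moment-split : ∀ i → (∀ k → monomial (H 0F k) i ≈ ι (+ 1)) → moment sys i ≈ ι (+ 6) + restMoment i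
    moment-split i one = trans (∑-head 5 (6 ∷ []) _)
      (+-congʳ (trans (∑-cong (6 ∷ []) (λ (k , _) → one k)) (∑-ι (6 ∷ []) (λ _ → 1))))

    module _ (i : Index [6,6,6,6]) (unb : balanced i ≡ false) (one : ∀ k → monomial (H 0F k) i ≈ ι (+ 1)) where
      private
        M = moment sys i
        W = restMoment i
        split = moment-split i one

      -- The design gives only - ∣M∣² ≥ 0; expanding ∣1 ± M∣² turns this into ∓ 2 Re M ≤ 1,
      -- which is sharp enough for both families.

      restMoment-lower : Pos (ι (+ 13) + twiceRe W)
      restMoment-lower = Pos-resp (begin
        (ι (+ 1) + M) * (ι (+ 1) + M) ᶜ - M * M ᶜ
          ≈⟨ solve 1 (λ M → (# (+ 1) ⊕ M) ⊗ (# (+ 1) ⊕ M) ⋆ ⊖ M ⊗ M ⋆ ≐ # (+ 1) ⊕ (M ⊕ M ⋆)) M ⟩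
        ι (+ 1) + (M + M ᶜ) ≈⟨ +-congˡ (+-cong split (ᶜ-cong split)) ⟩
        _ ≈⟨ solve 1 (λ W → # (+ 1) ⊕ (# (+ 6) ⊕ W ⊕ (# (+ 6) ⊕ W) ⋆) ≐ # (+ 13) ⊕ (W ⊕ W ⋆)) W ⟩
        ι (+ 13) + twiceRe W ∎) (Pos-+ (Pos-sq (ι (+ 1) + M)) (unbalanced-moment sys i unb))

      restMoment-upper : Pos (ι -[1+ 10 ] - twiceRe W)
      restMoment-upper = Pos-resp (begin
        (ι (+ 1) - M) * (ι (+ 1) - M) ᶜ - M * M ᶜ
          ≈⟨ solve 1 (λ M → (# (+ 1) ⊖ M) ⊗ (# (+ 1) ⊖ M) ⋆ ⊖ M ⊗ M ⋆ ≐ # (+ 1) ⊖ (M ⊕ M ⋆)) M ⟩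
        ι (+ 1) - (M + M ᶜ) ≈⟨ +-congˡ (-‿cong (+-cong split (ᶜ-cong split))) ⟩
        _ ≈⟨ solve 1 (λ W → # (+ 1) ⊖ (# (+ 6) ⊕ W ⊕ (# (+ 6) ⊕ W) ⋆) ≐ # -[1+ 10 ] ⊖ (W ⊕ W ⋆)) W ⟩
        ι -[1+ 10 ] - twiceRe W ∎) (Pos-+ (Pos-sq (ι (+ 1) - M)) (unbalanced-moment sys i unb))

    ∑-affine : ∀ k l (f : Index [5,6] → Carrier) →
      ∑ [5,6] (λ x → ι k + ι l * f x) ≈ ι k * ι (+ 30) + ι l * ∑ [5,6] f
    ∑-affine k l f = begin
      ∑ [5,6] (λ x → ι k + ι l * f x) ≈⟨ ∑-+ [5,6] _ _ ⟩
      ∑ [5,6] (λ x → ι k) + ∑ [5,6] (λ x → ι l * f x)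
        ≈⟨ +-cong (∑-cong [5,6] (λ _ → solve 1 (λ t → t ≐ t ⊗ # (+ 1)) (ι k))) (sym (*-∑ [5,6] (ι l) f)) ⟩
      ∑ [5,6] (λ x → ι k * ι (+ 1)) + ι l * ∑ [5,6] f
        ≈⟨ +-congʳ (trans (sym (*-∑ [5,6] (ι k) _)) (*-congˡ (∑-ι [5,6] (λ _ → 1)))) ⟩
      ι k * ι (+ 30) + ι l * ∑ [5,6] f ∎

    ∑-twiceRe₃ : ∀ i₁ i₂ i₃ → let m = λ x i → twiceRe (monomial (rest x) i) in
      ∑ [5,6] (λ x → m x i₁ + m x i₂ + m x i₃) ≈
      twiceRe (restMoment i₁) + twiceRe (restMoment i₂) + twiceRe (restMoment i₃)
    ∑-twiceRe₃ i₁ i₂ i₃ = trans (∑-+ [5,6] _ _) (+-cong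
      (trans (∑-+ [5,6] _ _) (+-cong (∑-twiceRe i₁) (∑-twiceRe i₂))) (∑-twiceRe i₃))

  -- Fourier matrices over the abstract ring

  module Fourier (ω : Carrier) (ω+ωᶜ : ι (+ 1) + ω + ω ᶜ ≈ ι (+ 0)) (ωωᶜ : ω * ω ᶜ ≈ ι (+ 1)) where

    -- Copies of the complex definitions over the abstract operations; `Fᵀ-sealed` identifies the
    -- resulting matrices with the original ones.
    f₀ f₁ f₂ : Vector Carrier 3
    f₀ = ι (+ 1) ∷ᵛ ι (+ 1) ∷ᵛ ι (+ 1) ∷ᵛ []ᵛ
    f₁ = ι (+ 1) ∷ᵛ ω ∷ᵛ ω ᶜ ∷ᵛ []ᵛ
    f₂ = ι (+ 1) ∷ᵛ ω ᶜ ∷ᵛ ω ∷ᵛ []ᵛ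

    Fᵀ-columns : Carrier → Carrier → Vector (Vector Carrier 6) 6
    Fᵀ-columns a b =
        (f₀ ++ᵛ f₀)
      ∷ᵛ (f₀ ++ᵛ mapᵛ -_ f₀)
      ∷ᵛ (f₁ ++ᵛ mapᵛ (a *_) f₁)
      ∷ᵛ (f₁ ++ᵛ mapᵛ ((- a) *_) f₁)
      ∷ᵛ (f₂ ++ᵛ mapᵛ (b *_) f₂)
      ∷ᵛ (f₂ ++ᵛ mapᵛ ((- b) *_) f₂)
      ∷ᵛ []ᵛ

    ω³ : ω * ω * ω ≈ ι (+ 1)
    ω³ = elim ωωᶜ (elim ω+ωᶜ (solve 1 (λ w → w ⊗ w ⊗ w ≐
      # (+ 1) ⊕ (# (+ 1) ⊖ w) ⊗ (w ⊗ w ⋆ ⊖ # (+ 1)) ⊕ w ⊗ (w ⊖ # (+ 1)) ⊗ (# (+ 1) ⊕ w ⊕ w ⋆ ⊖ # (+ 0))) ω))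

    sum₆ : ∀ (u : Vector Carrier 6) → sum u ≈ u 0F + u 1F + u 2F + u 3F + u 4F + u 5F
    sum₆ u = trans (+-congˡ (+-congˡ (+-congˡ (+-congˡ (+-congˡ (+-identityʳ _))))))
      (solve 6 (λ a b c d e f → a ⊕ (b ⊕ (c ⊕ (d ⊕ (e ⊕ f)))) ≐ a ⊕ b ⊕ c ⊕ d ⊕ e ⊕ f) _ _ _ _ _ _)

    inner₆ : ∀ (u v : Vector Carrier 6) → ⟪ u , v ⟫ ≈
      u 0F ᶜ * v 0F + u 1F ᶜ * v 1F + u 2F ᶜ * v 2F + u 3F ᶜ * v 3F + u 4F ᶜ * v 4F + u 5F ᶜ * v 5F
    inner₆ u v = sum₆ (λ i → u i ᶜ * v i)

    inner-congˡ : ∀ {u u′ : Vector Carrier 6} v → (∀ i → u i ≡ u′ i) → ⟪ u , v ⟫ ≈ ⟪ u′ , v ⟫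
    inner-congˡ v eq = sum-cong-≋ {6} (λ i → *-congʳ {x = v i} (ᶜ-cong (reflexive (eq i))))

    norm-cong : ∀ {x y} → x ≈ y → ∀ {n} → x * x ᶜ ≈ n → y * y ᶜ ≈ n
    norm-cong eq h = trans (sym (*-cong eq (ᶜ-cong eq))) h

    -- The transposed Fourier family

    module Transposed (a b : Carrier) (ua : Unit a) (ub : Unit b) where

      -- The columns come in pairs that agree on the upper half and are opposite on the lower half.
      -- `parallelogram` combines each pair into one Fourier component of the two halves of v, and a
      -- and b drop out.
      cyclic-of-unbiased : ∀ (v : Vector Carrier 6) →
        (∀ k → ⟪ Fᵀ-columns a b k , v ⟫ * ⟪ Fᵀ-columns a b k , v ⟫ ᶜ ≈ ι (+ 6)) →
        v 3F * v 4F ᶜ + v 4F * v 5F ᶜ + v 5F * v 3F ᶜ ≈ - (v 0F * v 1F ᶜ + v 1F * v 2F ᶜ + v 2F * v 0F ᶜ)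
      cyclic-of-unbiased v unb = cyclic-opposite ω ω+ωᶜ ωωᶜ
        (parallelogram one-unit (norm-cong e₀ (unb 0F)) (norm-cong e₁ (unb 1F)))
        (parallelogram (conj-unit ua) (norm-cong e₂ (unb 2F)) (norm-cong e₃ (unb 3F)))
        (parallelogram (conj-unit ub) (norm-cong e₄ (unb 4F)) (norm-cong e₅ (unb 5F)))
        where
        one-unit : ι (+ 1) * ι (+ 1) ᶜ ≈ ι (+ 1)
        one-unit = solve 0 (# (+ 1) ⊗ (# (+ 1)) ⋆ ≐ # (+ 1))
        conj-unit : ∀ {x} → Unit x → Unit (x ᶜ)
        conj-unit {x} ux = trans (solve 1 (λ x → x ⋆ ⊗ x ⋆ ⋆ ≐ x ⊗ x ⋆) x) ux
        e₀ : ⟪ Fᵀ-columns a b 0F , v ⟫ ≈ (v 0F + v 1F + v 2F) + ι (+ 1) * (v 3F + v 4F + v 5F)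
        e₀ = trans (inner₆ (Fᵀ-columns a b 0F) v) (solve 6 (λ v₀ v₁ v₂ v₃ v₄ v₅ → let 𝟙 = # (+ 1) in
          𝟙 ⋆ ⊗ v₀ ⊕ 𝟙 ⋆ ⊗ v₁ ⊕ 𝟙 ⋆ ⊗ v₂ ⊕ 𝟙 ⋆ ⊗ v₃ ⊕ 𝟙 ⋆ ⊗ v₄ ⊕ 𝟙 ⋆ ⊗ v₅ ≐
          v₀ ⊕ v₁ ⊕ v₂ ⊕ 𝟙 ⊗ (v₃ ⊕ v₄ ⊕ v₅)) _ _ _ _ _ _)
        e₁ : ⟪ Fᵀ-columns a b 1F , v ⟫ ≈ (v 0F + v 1F + v 2F) + (- ι (+ 1)) * (v 3F + v 4F + v 5F)
        e₁ = trans (inner₆ (Fᵀ-columns a b 1F) v) (solve 6 (λ v₀ v₁ v₂ v₃ v₄ v₅ → let 𝟙 = # (+ 1) in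
          𝟙 ⋆ ⊗ v₀ ⊕ 𝟙 ⋆ ⊗ v₁ ⊕ 𝟙 ⋆ ⊗ v₂ ⊕ (⊝ 𝟙) ⋆ ⊗ v₃ ⊕ (⊝ 𝟙) ⋆ ⊗ v₄ ⊕ (⊝ 𝟙) ⋆ ⊗ v₅ ≐
          v₀ ⊕ v₁ ⊕ v₂ ⊕ (⊝ 𝟙) ⊗ (v₃ ⊕ v₄ ⊕ v₅)) _ _ _ _ _ _)
        e₂ : ⟪ Fᵀ-columns a b 2F , v ⟫ ≈ (v 0F + ω ᶜ * v 1F + ω * v 2F) + a ᶜ * (v 3F + ω ᶜ * v 4F + ω * v 5F)
        e₂ = trans (inner₆ (Fᵀ-columns a b 2F) v) (solve 8 (λ w a v₀ v₁ v₂ v₃ v₄ v₅ → let 𝟙 = # (+ 1) in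
          𝟙 ⋆ ⊗ v₀ ⊕ w ⋆ ⊗ v₁ ⊕ w ⋆ ⋆ ⊗ v₂ ⊕ (a ⊗ 𝟙) ⋆ ⊗ v₃ ⊕ (a ⊗ w) ⋆ ⊗ v₄ ⊕ (a ⊗ w ⋆) ⋆ ⊗ v₅ ≐
          v₀ ⊕ w ⋆ ⊗ v₁ ⊕ w ⊗ v₂ ⊕ a ⋆ ⊗ (v₃ ⊕ w ⋆ ⊗ v₄ ⊕ w ⊗ v₅)) ω a _ _ _ _ _ _)
        e₃ : ⟪ Fᵀ-columns a b 3F , v ⟫ ≈ (v 0F + ω ᶜ * v 1F + ω * v 2F) + (- a ᶜ) * (v 3F + ω ᶜ * v 4F + ω * v 5F)
        e₃ = trans (inner₆ (Fᵀ-columns a b 3F) v) (solve 8 (λ w a v₀ v₁ v₂ v₃ v₄ v₅ → let 𝟙 = # (+ 1) in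
          𝟙 ⋆ ⊗ v₀ ⊕ w ⋆ ⊗ v₁ ⊕ w ⋆ ⋆ ⊗ v₂ ⊕ ((⊝ a) ⊗ 𝟙) ⋆ ⊗ v₃ ⊕ ((⊝ a) ⊗ w) ⋆ ⊗ v₄ ⊕ ((⊝ a) ⊗ w ⋆) ⋆ ⊗ v₅ ≐
          v₀ ⊕ w ⋆ ⊗ v₁ ⊕ w ⊗ v₂ ⊕ (⊝ a ⋆) ⊗ (v₃ ⊕ w ⋆ ⊗ v₄ ⊕ w ⊗ v₅)) ω a _ _ _ _ _ _)
        e₄ : ⟪ Fᵀ-columns a b 4F , v ⟫ ≈ (v 0F + ω * v 1F + ω ᶜ * v 2F) + b ᶜ * (v 3F + ω * v 4F + ω ᶜ * v 5F)
        e₄ = trans (inner₆ (Fᵀ-columns a b 4F) v) (solve 8 (λ w a v₀ v₁ v₂ v₃ v₄ v₅ → let 𝟙 = # (+ 1) in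
          𝟙 ⋆ ⊗ v₀ ⊕ w ⋆ ⋆ ⊗ v₁ ⊕ w ⋆ ⊗ v₂ ⊕ (a ⊗ 𝟙) ⋆ ⊗ v₃ ⊕ (a ⊗ w ⋆) ⋆ ⊗ v₄ ⊕ (a ⊗ w) ⋆ ⊗ v₅ ≐
          v₀ ⊕ w ⊗ v₁ ⊕ w ⋆ ⊗ v₂ ⊕ a ⋆ ⊗ (v₃ ⊕ w ⊗ v₄ ⊕ w ⋆ ⊗ v₅)) ω b _ _ _ _ _ _)
        e₅ : ⟪ Fᵀ-columns a b 5F , v ⟫ ≈ (v 0F + ω * v 1F + ω ᶜ * v 2F) + (- b ᶜ) * (v 3F + ω * v 4F + ω ᶜ * v 5F)
        e₅ = trans (inner₆ (Fᵀ-columns a b 5F) v) (solve 8 (λ w a v₀ v₁ v₂ v₃ v₄ v₅ → let 𝟙 = # (+ 1) in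
          𝟙 ⋆ ⊗ v₀ ⊕ w ⋆ ⋆ ⊗ v₁ ⊕ w ⋆ ⊗ v₂ ⊕ ((⊝ a) ⊗ 𝟙) ⋆ ⊗ v₃ ⊕ ((⊝ a) ⊗ w ⋆) ⋆ ⊗ v₄ ⊕ ((⊝ a) ⊗ w) ⋆ ⊗ v₅ ≐
          v₀ ⊕ w ⊗ v₁ ⊕ w ⋆ ⊗ v₂ ⊕ (⊝ a ⋆) ⊗ (v₃ ⊕ w ⊗ v₄ ⊕ w ⋆ ⊗ v₅)) ω b _ _ _ _ _ _)

      -- With ∣c∣² = 3 + terms, the total is 30 · (18 - 36) + 12 · 39 = -72.

      not-extendable : ∀ {H} → System H → (∀ k i → H 0F k i ≡ Fᵀ-columns a b k i) → ⊥
      not-extendable {H} sys H≡ = ¬Pos-ι 71 (Pos-resp (begin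
        ∑ [5,6] (λ x → ι -[1+ 17 ] + ι -[1+ 11 ] * terms x) + ι (+ 12) * lower
          ≈⟨ +-congʳ (trans (∑-affine -[1+ 17 ] -[1+ 11 ] terms) (+-congˡ (*-congˡ (∑-twiceRe₃ i₁ i₂ i₃)))) ⟩
        ι -[1+ 17 ] * ι (+ 30) + ι -[1+ 11 ] * (R i₁ + R i₂ + R i₃) + ι (+ 12) * lower
          ≈⟨ solve 3 (λ x y z → # -[1+ 17 ] ⊗ # (+ 30) ⊕ # -[1+ 11 ] ⊗ (x ⊕ y ⊕ z)
               ⊕ # (+ 12) ⊗ (# (+ 13) ⊕ x ⊕ (# (+ 13) ⊕ y) ⊕ (# (+ 13) ⊕ z)) ≐ # -[1+ 71 ]) (R i₁) (R i₂) (R i₃) ⟩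
        ι -[1+ 71 ] ∎)
        (Pos-+ (Pos-∑ [5,6] restPos) (Pos-ι* 12 (Pos-+ (Pos-+
          (restMoment-lower i₁ ≡.refl one₁) (restMoment-lower i₂ ≡.refl one₂)) (restMoment-lower i₃ ≡.refl one₃)))))
        where
        open System sys
        open Rest sys
        R : Index [6,6,6,6] → Carrier
        R i = twiceRe (restMoment i)
        i₁ i₂ i₃ : Index [6,6,6,6]
        -- These monomials and their conjugates are the off-diagonal terms of ∣c∣²: xzȳ², yxz̄² and
        -- yzx̄².
        i₁ = 0F , 2F , 1F , 1F , tt
        i₂ = 1F , 0F , 2F , 2F , tt
        i₃ = 1F , 2F , 0F , 0F , tt
        lower = ι (+ 13) + R i₁ + (ι (+ 13) + R i₂) + (ι (+ 13) + R i₃)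
        terms : Index [5,6] → Carrier
        terms x = twiceRe (monomial (rest x) i₁) + twiceRe (monomial (rest x) i₂) + twiceRe (monomial (rest x) i₃)
        restPos : ∀ x → Pos (ι -[1+ 17 ] + ι -[1+ 11 ] * terms x)
        restPos (j , k , _) = Pos-resp (elim uz (elim uy (elim ux (solve 3 (λ x y z →
            let c = x ⊗ y ⋆ ⊕ y ⊗ z ⋆ ⊕ z ⊗ x ⋆
                m = λ a b c → a ⊗ b ⊗ (c ⋆ ⊗ c ⋆) ⊕ (a ⊗ b ⊗ (c ⋆ ⊗ c ⋆)) ⋆
                A = x ⊗ x ⋆ ; B = y ⊗ y ⋆ ; C = z ⊗ z ⋆ ; 𝟙 = # (+ 1) ; k = # -[1+ 11 ]
            in # (+ 18) ⊖ # (+ 12) ⊗ (c ⊗ c ⋆) ≐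
               # -[1+ 17 ] ⊕ # -[1+ 11 ] ⊗ (m x z y ⊕ m y x z ⊕ m y z x)
               -- The cofactors telescope to -12(AB + BC + CA - 3), which reduces the diagonal part
               -- of ∣c∣² to 3.
               ⊕ k ⊗ (𝟙 ⊕ A) ⊗ (C ⊖ 𝟙) ⊕ k ⊗ (𝟙 ⊕ C) ⊗ (B ⊖ 𝟙) ⊕ k ⊗ (𝟙 ⊕ B) ⊗ (A ⊖ 𝟙)) (v 0F) (v 1F) (v 2F)))))
          (cyclic-bound ux uy uz (unit (suc j) k 3F) (unit (suc j) k 4F) (unit (suc j) k 5F)
            (cyclic-of-unbiased v unb))
          where
          v = H (suc j) k
          ux = unit (suc j) k 0F
          uy = unit (suc j) k 1F
          uz = unit (suc j) k 2F
          unb : ∀ l → ⟪ Fᵀ-columns a b l , v ⟫ * ⟪ Fᵀ-columns a b l , v ⟫ ᶜ ≈ ι (+ 6)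
          unb l = norm-cong (inner-congˡ v (H≡ l)) (unbiased {0F} {suc j} (λ ()) l k)
        oneF : ∀ i → (∀ k → monomial (Fᵀ-columns a b k) i ≈ ι (+ 1)) → ∀ k → monomial (H 0F k) i ≈ ι (+ 1)
        oneF (p , q , r , s , _) h k
          rewrite H≡ k p | H≡ k q | H≡ k r | H≡ k s = h k
        trivial-one : ι (+ 1) * ι (+ 1) * (ι (+ 1) ᶜ * ι (+ 1) ᶜ) ≈ ι (+ 1)
        trivial-one = solve 0 (# (+ 1) ⊗ # (+ 1) ⊗ ((# (+ 1)) ⋆ ⊗ (# (+ 1)) ⋆) ≐ # (+ 1))
        ωᶜ³ : ω ᶜ * ω ᶜ * ω ᶜ ≈ ι (+ 1)
        ωᶜ³ = trans (solve 1 (λ w → w ⋆ ⊗ w ⋆ ⊗ w ⋆ ≐ (w ⊗ w ⊗ w) ⋆) ω) (trans (ᶜ-cong ω³) (ᶜ-ι _))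
        A₁ : ι (+ 1) * ω ᶜ * (ω ᶜ * ω ᶜ) ≈ ι (+ 1)
        A₁ = trans (solve 1 (λ w → # (+ 1) ⊗ w ⋆ ⊗ (w ⋆ ⊗ w ⋆) ≐ w ⋆ ⊗ w ⋆ ⊗ w ⋆) ω) ωᶜ³
        A₂ : ω * ι (+ 1) * (ω ᶜ ᶜ * ω ᶜ ᶜ) ≈ ι (+ 1)
        A₂ = trans (solve 1 (λ w → w ⊗ # (+ 1) ⊗ (w ⋆ ⋆ ⊗ w ⋆ ⋆) ≐ w ⊗ w ⊗ w) ω) ω³
        A₃ : ω * ω ᶜ * (ι (+ 1) ᶜ * ι (+ 1) ᶜ) ≈ ι (+ 1)
        A₃ = trans (solve 1 (λ w → w ⊗ w ⋆ ⊗ ((# (+ 1)) ⋆ ⊗ (# (+ 1)) ⋆) ≐ w ⊗ w ⋆) ω) ωωᶜ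
        B₁ : ι (+ 1) * ω * (ω ᶜ ᶜ * ω ᶜ ᶜ) ≈ ι (+ 1)
        B₁ = trans (*-congʳ (*-comm _ _)) A₂
        B₂ : ω ᶜ * ι (+ 1) * (ω ᶜ * ω ᶜ) ≈ ι (+ 1)
        B₂ = trans (*-congʳ (*-comm _ _)) A₁
        B₃ : ω ᶜ * ω * (ι (+ 1) ᶜ * ι (+ 1) ᶜ) ≈ ι (+ 1)
        B₃ = trans (*-congʳ (*-comm _ _)) A₃
        one₁ : ∀ k → monomial (H 0F k) i₁ ≈ ι (+ 1)
        -- The indices stay in the upper half, where the two columns of a pair coincide.
        one₁ = oneF i₁ λ { 0F → trivial-one ; 1F → trivial-one ; 2F → A₁ ; 3F → A₁ ; 4F → B₁ ; 5F → B₁ }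
        one₂ : ∀ k → monomial (H 0F k) i₂ ≈ ι (+ 1)
        one₂ = oneF i₂ λ { 0F → trivial-one ; 1F → trivial-one ; 2F → A₂ ; 3F → A₂ ; 4F → B₂ ; 5F → B₂ }
        one₃ : ∀ k → monomial (H 0F k) i₃ ≈ ι (+ 1)
        one₃ = oneF i₃ λ { 0F → trivial-one ; 1F → trivial-one ; 2F → A₃ ; 3F → A₃ ; 4F → B₃ ; 5F → B₃ }

    -- The Fourier family

    module Direct (a b : Carrier) (ua : Unit a) (ub : Unit b) where

      -- On each of the coordinate pairs 01, 23, 45 the first three columns of F(a, b) have equal
      -- entries and the last three opposite ones. They yield the Fourier components of the sums and
      -- of the differences; the factors aᶜ, bᶜ on the latter leave the norms unchanged.
      e₂-of-unbiased : ∀ (v : Vector Carrier 6) → (∀ i → Unit (v i)) →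
        (∀ k → let h = λ i → Fᵀ-columns a b i k in ⟪ h , v ⟫ * ⟪ h , v ⟫ ᶜ ≈ ι (+ 6)) →
        let p = v 0F * v 1F ᶜ ; q = v 2F * v 3F ᶜ ; r = v 4F * v 5F ᶜ ; P = p + p ᶜ ; Q = q + q ᶜ ; R = r + r ᶜ in
        Pos (ι (+ 96) + ι (+ 48) * (P * Q + Q * R + R * P))
      e₂-of-unbiased v uv unb = e₂-bound p q r
        (elim (proj₁ bound⁺) (solve 3 (λ p q r → let P = p ⊕ p ⋆ ; Q = q ⊕ q ⋆ ; R = r ⊕ r ⋆ in
          P ⊕ Q ⊕ R ≐ # (+ 0) ⊕ # (+ 1) ⊗ (# (+ 2) ⊕ P ⊕ (# (+ 2) ⊕ Q) ⊕ (# (+ 2) ⊕ R) ⊖ # (+ 6))) p q r))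
        (proj₂ bound⁺) (proj₂ bound⁻)
        where
        p = v 0F * v 1F ᶜ
        q = v 2F * v 3F ᶜ
        r = v 4F * v 5F ᶜ
        norm⁺ : ∀ {x y} → Unit x → Unit y → (x + y) * (x + y) ᶜ ≈ ι (+ 2) + (x * y ᶜ + (x * y ᶜ) ᶜ)
        norm⁺ {x} {y} ux uy = elim uy (elim ux (solve 2 (λ x y → (x ⊕ y) ⊗ (x ⊕ y) ⋆ ≐
          # (+ 2) ⊕ (x ⊗ y ⋆ ⊕ (x ⊗ y ⋆) ⋆) ⊕ # (+ 1) ⊗ (y ⊗ y ⋆ ⊖ # (+ 1)) ⊕ # (+ 1) ⊗ (x ⊗ x ⋆ ⊖ # (+ 1))) x y))
        norm⁻ : ∀ {x y} → Unit x → Unit y → (x - y) * (x - y) ᶜ ≈ ι (+ 2) - (x * y ᶜ + (x * y ᶜ) ᶜ)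
        norm⁻ {x} {y} ux uy = elim uy (elim ux (solve 2 (λ x y → (x ⊖ y) ⊗ (x ⊖ y) ⋆ ≐
          # (+ 2) ⊖ (x ⊗ y ⋆ ⊕ (x ⊗ y ⋆) ⋆) ⊕ # (+ 1) ⊗ (y ⊗ y ⋆ ⊖ # (+ 1)) ⊕ # (+ 1) ⊗ (x ⊗ x ⋆ ⊖ # (+ 1))) x y))
        scaled : ∀ {α x n} → Unit α → x * x ᶜ ≈ n → (α ᶜ * x) * (α ᶜ * x) ᶜ ≈ n
        scaled {α} {x} {n} uα h = trans (elim uα (solve 2 (λ α x → (α ⋆ ⊗ x) ⊗ (α ⋆ ⊗ x) ⋆ ≐
          x ⊗ x ⋆ ⊕ (x ⊗ x ⋆) ⊗ (α ⊗ α ⋆ ⊖ # (+ 1))) α x)) h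
        e₀ : ⟪ (λ i → Fᵀ-columns a b i 0F) , v ⟫ ≈ (v 0F + v 1F) + (v 2F + v 3F) + (v 4F + v 5F)
        e₀ = trans (inner₆ (λ i → Fᵀ-columns a b i 0F) v) (solve 6 (λ v₀ v₁ v₂ v₃ v₄ v₅ → let 𝟙 = # (+ 1) in
          𝟙 ⋆ ⊗ v₀ ⊕ 𝟙 ⋆ ⊗ v₁ ⊕ 𝟙 ⋆ ⊗ v₂ ⊕ 𝟙 ⋆ ⊗ v₃ ⊕ 𝟙 ⋆ ⊗ v₄ ⊕ 𝟙 ⋆ ⊗ v₅ ≐
          (v₀ ⊕ v₁) ⊕ (v₂ ⊕ v₃) ⊕ (v₄ ⊕ v₅)) _ _ _ _ _ _)
        e₁ : ⟪ (λ i → Fᵀ-columns a b i 1F) , v ⟫ ≈ (v 0F + v 1F) + ω ᶜ * (v 2F + v 3F) + ω * (v 4F + v 5F)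
        e₁ = trans (inner₆ (λ i → Fᵀ-columns a b i 1F) v) (solve 7 (λ w v₀ v₁ v₂ v₃ v₄ v₅ → let 𝟙 = # (+ 1) in
          𝟙 ⋆ ⊗ v₀ ⊕ 𝟙 ⋆ ⊗ v₁ ⊕ w ⋆ ⊗ v₂ ⊕ w ⋆ ⊗ v₃ ⊕ w ⋆ ⋆ ⊗ v₄ ⊕ w ⋆ ⋆ ⊗ v₅ ≐
          (v₀ ⊕ v₁) ⊕ w ⋆ ⊗ (v₂ ⊕ v₃) ⊕ w ⊗ (v₄ ⊕ v₅)) ω _ _ _ _ _ _)
        e₂ : ⟪ (λ i → Fᵀ-columns a b i 2F) , v ⟫ ≈ (v 0F + v 1F) + ω * (v 2F + v 3F) + ω ᶜ * (v 4F + v 5F)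
        e₂ = trans (inner₆ (λ i → Fᵀ-columns a b i 2F) v) (solve 7 (λ w v₀ v₁ v₂ v₃ v₄ v₅ → let 𝟙 = # (+ 1) in
          𝟙 ⋆ ⊗ v₀ ⊕ 𝟙 ⋆ ⊗ v₁ ⊕ w ⋆ ⋆ ⊗ v₂ ⊕ w ⋆ ⋆ ⊗ v₃ ⊕ w ⋆ ⊗ v₄ ⊕ w ⋆ ⊗ v₅ ≐
          (v₀ ⊕ v₁) ⊕ w ⊗ (v₂ ⊕ v₃) ⊕ w ⋆ ⊗ (v₄ ⊕ v₅)) ω _ _ _ _ _ _)
        e₃ : ⟪ (λ i → Fᵀ-columns a b i 3F) , v ⟫ ≈ (v 0F - v 1F) + a ᶜ * (v 2F - v 3F) + b ᶜ * (v 4F - v 5F)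
        e₃ = trans (inner₆ (λ i → Fᵀ-columns a b i 3F) v) (solve 8 (λ a b v₀ v₁ v₂ v₃ v₄ v₅ → let 𝟙 = # (+ 1) in
          𝟙 ⋆ ⊗ v₀ ⊕ (⊝ 𝟙) ⋆ ⊗ v₁ ⊕ (a ⊗ 𝟙) ⋆ ⊗ v₂ ⊕ ((⊝ a) ⊗ 𝟙) ⋆ ⊗ v₃ ⊕ (b ⊗ 𝟙) ⋆ ⊗ v₄ ⊕ ((⊝ b) ⊗ 𝟙) ⋆ ⊗ v₅ ≐
          (v₀ ⊖ v₁) ⊕ a ⋆ ⊗ (v₂ ⊖ v₃) ⊕ b ⋆ ⊗ (v₄ ⊖ v₅)) a b _ _ _ _ _ _)
        e₄ : ⟪ (λ i → Fᵀ-columns a b i 4F) , v ⟫ ≈ (v 0F - v 1F) + ω ᶜ * (a ᶜ * (v 2F - v 3F)) + ω * (b ᶜ * (v 4F - v 5F))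
        e₄ = trans (inner₆ (λ i → Fᵀ-columns a b i 4F) v) (solve 9 (λ w a b v₀ v₁ v₂ v₃ v₄ v₅ → let 𝟙 = # (+ 1) in
          𝟙 ⋆ ⊗ v₀ ⊕ (⊝ 𝟙) ⋆ ⊗ v₁ ⊕ (a ⊗ w) ⋆ ⊗ v₂ ⊕ ((⊝ a) ⊗ w) ⋆ ⊗ v₃ ⊕ (b ⊗ w ⋆) ⋆ ⊗ v₄ ⊕ ((⊝ b) ⊗ w ⋆) ⋆ ⊗ v₅ ≐
          (v₀ ⊖ v₁) ⊕ w ⋆ ⊗ (a ⋆ ⊗ (v₂ ⊖ v₃)) ⊕ w ⊗ (b ⋆ ⊗ (v₄ ⊖ v₅))) ω a b _ _ _ _ _ _)
        e₅ : ⟪ (λ i → Fᵀ-columns a b i 5F) , v ⟫ ≈ (v 0F - v 1F) + ω * (a ᶜ * (v 2F - v 3F)) + ω ᶜ * (b ᶜ * (v 4F - v 5F))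
        e₅ = trans (inner₆ (λ i → Fᵀ-columns a b i 5F) v) (solve 9 (λ w a b v₀ v₁ v₂ v₃ v₄ v₅ → let 𝟙 = # (+ 1) in
          𝟙 ⋆ ⊗ v₀ ⊕ (⊝ 𝟙) ⋆ ⊗ v₁ ⊕ (a ⊗ w ⋆) ⋆ ⊗ v₂ ⊕ ((⊝ a) ⊗ w ⋆) ⋆ ⊗ v₃ ⊕ (b ⊗ w) ⋆ ⊗ v₄ ⊕ ((⊝ b) ⊗ w) ⋆ ⊗ v₅ ≐
          (v₀ ⊖ v₁) ⊕ w ⊗ (a ⋆ ⊗ (v₂ ⊖ v₃)) ⊕ w ⋆ ⊗ (b ⋆ ⊗ (v₄ ⊖ v₅))) ω a b _ _ _ _ _ _)
        bound⁺ = heron-bound ω ω+ωᶜ ωωᶜ (norm-cong e₀ (unb 0F)) (norm-cong e₁ (unb 1F)) (norm-cong e₂ (unb 2F))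
          (norm⁺ (uv 0F) (uv 1F)) (norm⁺ (uv 2F) (uv 3F)) (norm⁺ (uv 4F) (uv 5F))
        bound⁻ = heron-bound ω ω+ωᶜ ωωᶜ (norm-cong e₃ (unb 3F)) (norm-cong e₄ (unb 4F)) (norm-cong e₅ (unb 5F))
          (norm⁻ (uv 0F) (uv 1F)) (scaled ua (norm⁻ (uv 2F) (uv 3F))) (scaled ub (norm⁻ (uv 4F) (uv 5F)))

      -- Both products regroup to s · s; for the second, one ratio is conjugated, and `ι s` is
      -- self-conjugate.
      paired : ∀ {x x′ y y′ s} → ι s * ι s ≈ ι (+ 1) → x * x′ ᶜ ≈ ι s → y * y′ ᶜ ≈ ι s →
        x * y * (x′ ᶜ * y′ ᶜ) ≈ ι (+ 1) × x * y′ * (x′ ᶜ * y ᶜ) ≈ ι (+ 1)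
      paired {x} {x′} {y} {y′} {s} s² xs ys =
        trans (solve 4 (λ x x′ y y′ → x ⊗ y ⊗ (x′ ⋆ ⊗ y′ ⋆) ≐ (x ⊗ x′ ⋆) ⊗ (y ⊗ y′ ⋆)) x x′ y y′)
          (trans (*-cong xs ys) s²) ,
        trans (solve 4 (λ x x′ y y′ → x ⊗ y′ ⊗ (x′ ⋆ ⊗ y ⋆) ≐ (x ⊗ x′ ⋆) ⊗ (y ⊗ y′ ⋆) ⋆) x x′ y y′)
          (trans (*-cong xs (trans (ᶜ-cong ys) (ᶜ-ι s))) s²)

      -- The total is 30 · 96 - 48 · 66 = -288.

      not-extendable : ∀ {H} → System H → (∀ k i → H 0F k i ≡ Fᵀ-columns a b i k) → ⊥
      not-extendable {H} sys H≡ = ¬Pos-ι 287 (Pos-resp (begin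
        ∑ [5,6] (λ x → ι (+ 96) + ι (+ 48) * terms x) + ι (+ 48) * upper
          ≈⟨ +-congʳ (trans (∑-affine (+ 96) (+ 48) terms) (+-congˡ (*-congˡ
               (trans (∑-+ [5,6] _ _) (+-cong (∑-twiceRe₃ i₁ i₂ i₃) (∑-twiceRe₃ j₁ j₂ j₃)))))) ⟩
        ι (+ 96) * ι (+ 30) + ι (+ 48) * (R i₁ + R i₂ + R i₃ + (R j₁ + R j₂ + R j₃)) + ι (+ 48) * upper
          ≈⟨ solve 6 (λ x y z x′ y′ z′ → let k = # -[1+ 10 ] in
               # (+ 96) ⊗ # (+ 30) ⊕ # (+ 48) ⊗ (x ⊕ y ⊕ z ⊕ (x′ ⊕ y′ ⊕ z′))
               ⊕ # (+ 48) ⊗ ((k ⊖ x) ⊕ (k ⊖ y) ⊕ (k ⊖ z) ⊕ ((k ⊖ x′) ⊕ (k ⊖ y′) ⊕ (k ⊖ z′))) ≐ # -[1+ 287 ])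
               (R i₁) (R i₂) (R i₃) (R j₁) (R j₂) (R j₃) ⟩
        ι -[1+ 287 ] ∎)
        (Pos-+ (Pos-∑ [5,6] restPos) (Pos-ι* 48 (Pos-+
          (Pos-+ (Pos-+ (up i₁ ≡.refl (λ k → proj₁ (pairs k 0F 1F 2F 3F (p₀₁ k) (p₂₃ k))))
                        (up i₂ ≡.refl (λ k → proj₁ (pairs k 2F 3F 4F 5F (p₂₃ k) (p₄₅ k)))))
                        (up i₃ ≡.refl (λ k → proj₁ (pairs k 4F 5F 0F 1F (p₄₅ k) (p₀₁ k)))))
          (Pos-+ (Pos-+ (up j₁ ≡.refl (λ k → proj₂ (pairs k 0F 1F 2F 3F (p₀₁ k) (p₂₃ k))))
                        (up j₂ ≡.refl (λ k → proj₂ (pairs k 2F 3F 4F 5F (p₂₃ k) (p₄₅ k)))))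
                        (up j₃ ≡.refl (λ k → proj₂ (pairs k 4F 5F 0F 1F (p₄₅ k) (p₀₁ k)))))))))
        where
        open System sys
        open Rest sys
        up = restMoment-upper
        R : Index [6,6,6,6] → Carrier
        R i = twiceRe (restMoment i)
        i₁ i₂ i₃ j₁ j₂ j₃ : Index [6,6,6,6]
        -- Since PQ = 2 Re pq + 2 Re pq̄, the first three quadruples encode pq, qr, rp and the last
        -- three pq̄, qr̄, rp̄.
        i₁ = 0F , 2F , 1F , 3F , tt
        i₂ = 2F , 4F , 3F , 5F , tt
        i₃ = 4F , 0F , 5F , 1F , tt
        j₁ = 0F , 3F , 1F , 2F , tt
        j₂ = 2F , 5F , 3F , 4F , tt
        j₃ = 4F , 1F , 5F , 0F , tt
        u : Index [6,6,6,6] → Carrier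
        u i = ι -[1+ 10 ] - R i
        upper = u i₁ + u i₂ + u i₃ + (u j₁ + u j₂ + u j₃)
        terms : Index [5,6] → Carrier
        terms x = let m = λ i → twiceRe (monomial (rest x) i) in
          m i₁ + m i₂ + m i₃ + (m j₁ + m j₂ + m j₃)
        restPos : ∀ x → Pos (ι (+ 96) + ι (+ 48) * terms x)
        restPos (j , k , _) = Pos-resp (solve 6 (λ v₀ v₁ v₂ v₃ v₄ v₅ →
            let p = v₀ ⊗ v₁ ⋆ ; q = v₂ ⊗ v₃ ⋆ ; r = v₄ ⊗ v₅ ⋆ ; P = p ⊕ p ⋆ ; Q = q ⊕ q ⋆ ; R = r ⊕ r ⋆
                m = λ a b c d → a ⊗ b ⊗ (c ⋆ ⊗ d ⋆) ⊕ (a ⊗ b ⊗ (c ⋆ ⊗ d ⋆)) ⋆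
            in # (+ 96) ⊕ # (+ 48) ⊗ (P ⊗ Q ⊕ Q ⊗ R ⊕ R ⊗ P) ≐
               # (+ 96) ⊕ # (+ 48) ⊗ (m v₀ v₂ v₁ v₃ ⊕ m v₂ v₄ v₃ v₅ ⊕ m v₄ v₀ v₅ v₁ ⊕
                 (m v₀ v₃ v₁ v₂ ⊕ m v₂ v₅ v₃ v₄ ⊕ m v₄ v₁ v₅ v₀)))
            (v 0F) (v 1F) (v 2F) (v 3F) (v 4F) (v 5F))
          (e₂-of-unbiased v (unit (suc j) k) unb)
          where
          v = H (suc j) k
          unb : ∀ l → let h = λ i → Fᵀ-columns a b i l in ⟪ h , v ⟫ * ⟪ h , v ⟫ ᶜ ≈ ι (+ 6)
          unb l = norm-cong (inner-congˡ v (H≡ l)) (unbiased {0F} {suc j} (λ ()) l k)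
        -- The common value of h₀h̄₁, h₂h̄₃ and h₄h̄₅ on column k of F(a, b).
        sign : Fin 6 → ℤ.ℤ
        sign 0F = + 1
        sign 1F = + 1
        sign 2F = + 1
        sign 3F = -[1+ 0 ]
        sign 4F = -[1+ 0 ]
        sign 5F = -[1+ 0 ]
        sign² : ∀ k → ι (sign k) * ι (sign k) ≈ ι (+ 1)
        sign² 0F = sym (ι-* _ _)
        sign² 1F = sym (ι-* _ _)
        sign² 2F = sym (ι-* _ _)
        sign² 3F = sym (ι-* _ _)
        sign² 4F = sym (ι-* _ _)
        sign² 5F = sym (ι-* _ _)
        pairs : ∀ k x x′ y y′ → let h = H 0F k in h x * h x′ ᶜ ≈ ι (sign k) → h y * h y′ ᶜ ≈ ι (sign k) →
          h x * h y * (h x′ ᶜ * h y′ ᶜ) ≈ ι (+ 1) × h x * h y′ * (h x′ ᶜ * h y ᶜ) ≈ ι (+ 1)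
        pairs k x x′ y y′ = paired (sign² k)
        uF : ∀ k i → Unit (Fᵀ-columns a b i k)
        uF k i = ≡.subst Unit (H≡ k i) (unit 0F k i)
        neg-unit : ∀ {α x} → Unit (α * x) → (α * x) * ((- α) * x) ᶜ ≈ ι -[1+ 0 ]
        neg-unit {α} {x} ux = elim ux (solve 2 (λ α x → (α ⊗ x) ⊗ ((⊝ α) ⊗ x) ⋆ ≐
          # -[1+ 0 ] ⊕ # -[1+ 0 ] ⊗ ((α ⊗ x) ⊗ (α ⊗ x) ⋆ ⊖ # (+ 1))) α x)
        neg-one : ι (+ 1) * (- ι (+ 1)) ᶜ ≈ ι -[1+ 0 ]
        neg-one = solve 0 (# (+ 1) ⊗ (⊝ # (+ 1)) ⋆ ≐ # -[1+ 0 ])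
        viaF : ∀ k x y {s} → Fᵀ-columns a b x k * Fᵀ-columns a b y k ᶜ ≈ s → H 0F k x * H 0F k y ᶜ ≈ s
        viaF k x y h rewrite H≡ k x | H≡ k y = h
        p₀₁ : ∀ k → H 0F k 0F * H 0F k 1F ᶜ ≈ ι (sign k)
        p₀₁ k = viaF k 0F 1F (go k) where
          go : ∀ k → Fᵀ-columns a b 0F k * Fᵀ-columns a b 1F k ᶜ ≈ ι (sign k)
          -- In the first three columns the two entries are definitionally equal, so unimodularity
          -- is already the claim.
          go 0F = uF 0F 0F
          go 1F = uF 1F 0F
          go 2F = uF 2F 0F
          go 3F = neg-one
          go 4F = neg-one
          go 5F = neg-one
        p₂₃ : ∀ k → H 0F k 2F * H 0F k 3F ᶜ ≈ ι (sign k)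
        p₂₃ k = viaF k 2F 3F (go k) where
          go : ∀ k → Fᵀ-columns a b 2F k * Fᵀ-columns a b 3F k ᶜ ≈ ι (sign k)
          go 0F = uF 0F 2F
          go 1F = uF 1F 2F
          go 2F = uF 2F 2F
          go 3F = neg-unit (uF 3F 2F)
          go 4F = neg-unit (uF 4F 2F)
          go 5F = neg-unit (uF 5F 2F)
        p₄₅ : ∀ k → H 0F k 4F * H 0F k 5F ᶜ ≈ ι (sign k)
        p₄₅ k = viaF k 4F 5F (go k) where
          go : ∀ k → Fᵀ-columns a b 4F k * Fᵀ-columns a b 5F k ᶜ ≈ ι (sign k)
          go 0F = uF 0F 4F
          go 1F = uF 1F 4F
          go 2F = uF 2F 4F
          go 3F = neg-unit (uF 3F 4F)
          go 4F = neg-unit (uF 4F 4F)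
          go 5F = neg-unit (uF 5F 4F)

-- Real and complex numbers

open import Defs
open ℚ-lemmas
open Cauchy-lemmas
open +-*-Solver

-- Null sequences of rationals

module NullSequences where

  -- `x ≃ y` unfolds to `Null` of the termwise difference, so the congruence laws below are closure
  -- properties of null sequences.
  Null : (ℕ → ℚ) → Set
  Null s = ∀ ε → 0ℚ ℚ.< ε → ∃ λ N → ∀ n → N ℕ.≤ n → ℚ.∣ s n ∣ ℚ.< ε

  Null-resp : ∀ {s t} → (∀ n → s n ≡ t n) → Null s → Null t
  Null-resp eq h ε ε>0 with h ε ε>0
  ... | N , p = N , λ n ≤n → ≡.subst (λ r → ℚ.∣ r ∣ ℚ.< ε) (eq n) (p n ≤n)

  Null-zero : ∀ {s} → (∀ n → s n ≡ 0ℚ) → Null s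
  Null-zero eq ε ε>0 = 0 , λ n _ → ≡.subst (λ r → ℚ.∣ r ∣ ℚ.< ε) (≡.sym (eq n)) ε>0

  Null-+ : ∀ {s t} → Null s → Null t → Null (λ n → s n ℚ.+ t n)
  Null-+ {s} {t} hs ht ε ε>0 with hs (½ ℚ.* ε) (0<½ε ε>0) | ht (½ ℚ.* ε) (0<½ε ε>0)
  ... | M , p | N , q = M ℕ.⊔ N , λ n ≤n → ℚ.≤-<-trans (ℚ.∣p+q∣≤∣p∣+∣q∣ (s n) (t n))
    (+-<-halves (p n (ℕ.m⊔n≤o⇒m≤o M N ≤n)) (q n (ℕ.m⊔n≤o⇒n≤o M N ≤n)))

  Null-neg : ∀ {s} → Null s → Null (λ n → ℚ.- s n)
  Null-neg {s} h ε ε>0 with h ε ε>0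
  ... | N , p = N , λ n ≤n → ≡.subst (ℚ._< ε) (≡.sym (ℚ.∣-p∣≡∣p∣ (s n))) (p n ≤n)

  Null-* : ∀ {s t} → Cauchy s → Null t → Null (λ n → s n ℚ.* t n)
  Null-* {s} {t} cs ht ε ε>0 =
    let (B , M , s≤) = bounded {s} cs
        (η , η>0 , small) = shrink B ε ε>0
        (N , t<) = ht η η>0
    in M ℕ.⊔ N , λ n ≤n → small {s n} {t n} (s≤ n (ℕ.m⊔n≤o⇒m≤o M N ≤n)) (t< n (ℕ.m⊔n≤o⇒n≤o M N ≤n))

  Null-squeeze : ∀ {s t} → (∀ n → 0ℚ ℚ.≤ s n) → (∀ n → s n ℚ.≤ t n) → Null t → Null s
  Null-squeeze {s} {t} 0≤s s≤t h ε ε>0 with h ε ε>0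
  ... | N , p = N , λ n ≤n → ≡.subst (ℚ._< ε) (≡.sym (ℚ.0≤p⇒∣p∣≡p (0≤s n)))
    (ℚ.≤-<-trans (s≤t n) (ℚ.≤-<-trans (p≤∣p∣ (t n)) (p n ≤n)))

  Null-δ : Null δ
  Null-δ ε ε>0 with archimedean ε ε>0
  ... | N , p = N , λ n ≤n → ≡.subst (ℚ._< ε) (≡.sym (ℚ.0≤p⇒∣p∣≡p (ℚ.<⇒≤ (0<δ n)))) (p n ≤n)

  Null⇒Cauchy : ∀ {s} → Null s → Cauchy s
  Null⇒Cauchy {s} h ε ε>0 with h (½ ℚ.* ε) (0<½ε ε>0)
  ... | N , p = N , λ m n ≤m ≤n → ℚ.≤-<-trans (ℚ.∣p+q∣≤∣p∣+∣q∣ (s m) (ℚ.- s n))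
    (+-<-halves (p m ≤m) (≡.subst (ℚ._< ½ ℚ.* ε) (≡.sym (ℚ.∣-p∣≡∣p∣ (s n))) (p n ≤n)))

open NullSequences

pointwise : ∀ {x y} → (∀ n → seq x n ≡ seq y n) → x ≃ y
pointwise {x} {y} eq = Null-zero (λ n → ≡.trans (≡.cong (ℚ._- seq y n) (eq n)) (ℚ.+-inverseʳ (seq y n)))

≃-refl : ∀ {x} → x ≃ x
≃-refl {x} = pointwise {x} {x} (λ _ → ≡.refl)

≃-sym : ∀ {x y} → x ≃ y → y ≃ x
≃-sym {x} {y} h = Null-resp (λ n → solve 2 (λ a b → :- (a :- b) := b :- a) ≡.refl (seq x n) (seq y n)) (Null-neg {λ n → seq x n ℚ.- seq y n} h)

≃-trans : ∀ {x y z} → x ≃ y → y ≃ z → x ≃ z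
≃-trans {x} {y} {z} h k = Null-resp (λ n →
  solve 3 (λ a b c → (a :- b) :+ (b :- c) := a :- c) ≡.refl (seq x n) (seq y n) (seq z n)) (Null-+ {λ n → seq x n ℚ.- seq y n} {λ n → seq y n ℚ.- seq z n} h k)

+ℝ-cong : ∀ {x y u v} → x ≃ y → u ≃ v → x +ℝ u ≃ y +ℝ v
+ℝ-cong {x} {y} {u} {v} h k = Null-resp (λ n →
  solve 4 (λ a b c d → (a :- b) :+ (c :- d) := (a :+ c) :- (b :+ d)) ≡.refl
    (seq x n) (seq y n) (seq u n) (seq v n)) (Null-+ {λ n → seq x n ℚ.- seq y n} {λ n → seq u n ℚ.- seq v n} h k)

-ℝ-cong : ∀ {x y} → x ≃ y → -ℝ x ≃ -ℝ y
-ℝ-cong {x} {y} h = Null-resp (λ n →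
  solve 2 (λ a b → :- (a :- b) := (:- a) :- (:- b)) ≡.refl (seq x n) (seq y n)) (Null-neg {λ n → seq x n ℚ.- seq y n} h)

*ℝ-cong : ∀ {x y u v} → x ≃ y → u ≃ v → x *ℝ u ≃ y *ℝ v
*ℝ-cong {x} {y} {u} {v} h k = Null-resp (λ n →
  solve 4 (λ a b c d → a :* (c :- d) :+ d :* (a :- b) := a :* c :- b :* d) ≡.refl
    (seq x n) (seq y n) (seq u n) (seq v n)) (Null-+ {λ n → seq x n ℚ.* du n} {λ n → seq v n ℚ.* dx n} (Null-* {seq x} {du} (cauchy x) k) (Null-* {seq v} {dx} (cauchy v) h))
  where
  dx du : ℕ → ℚ
  dx n = seq x n ℚ.- seq y n
  du n = seq u n ℚ.- seq v n

-- The approximants satisfy s² ≤ x < (s + δ)², so x - s² lies between 0 and 2sδ + δ², which is null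
-- because s is Cauchy and hence bounded.
√-square : ∀ x → (∀ n → 0ℚ ℚ.≤ seq x n) → √ x *ℝ √ x ≃ x
√-square x 0≤x = ≃-sym {x} {√ x *ℝ √ x} (Null-squeeze {λ n → seq x n ℚ.- s n ℚ.* s n} lower upper
  (Null-+ {λ n → s n ℚ.* δ n ℚ.+ s n ℚ.* δ n} {λ n → δ n ℚ.* δ n} (Null-+ {sδ} {sδ} Null-sδ Null-sδ) (Null-* {δ} {δ} (Null⇒Cauchy Null-δ) Null-δ)))
  where
  s : ℕ → ℚ
  s = seq (√ x)
  sδ : ℕ → ℚ
  sδ n = s n ℚ.* δ n
  Null-sδ : Null sδ
  Null-sδ = Null-* {s} {δ} (cauchy (√ x)) Null-δ
  square-≤ : ∀ n → s n ℚ.* s n ℚ.≤ seq x n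
  square-≤ n with √ℚ-lower n (seq x n)
  -- The default root 0 obeys the bound because the term of x is nonnegative.
  ... | inj₁ s≡0 = ≡.subst (ℚ._≤ seq x n) (≡.sym (≡.trans (≡.cong (ℚ._* s n) s≡0) (ℚ.*-zeroˡ (s n)))) (0≤x n)
  ... | inj₂ s²≤ = s²≤
  lower : ∀ n → 0ℚ ℚ.≤ seq x n ℚ.- s n ℚ.* s n
  lower n = ≡.subst (ℚ._≤ seq x n ℚ.- s n ℚ.* s n) (ℚ.+-inverseʳ (s n ℚ.* s n))
    (ℚ.+-monoˡ-≤ (ℚ.- (s n ℚ.* s n)) (square-≤ n))
  upper : ∀ n → seq x n ℚ.- s n ℚ.* s n ℚ.≤ s n ℚ.* δ n ℚ.+ s n ℚ.* δ n ℚ.+ δ n ℚ.* δ n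
  upper n = ℚ.≤-trans (ℚ.+-monoˡ-≤ (ℚ.- (s n ℚ.* s n)) (ℚ.<⇒≤ (√ℚ-upper n (seq x n))))
    (ℚ.≤-reflexive (solve 2 (λ s d → (s :+ d) :* (s :+ d) :- s :* s := s :* d :+ s :* d :+ d :* d) ≡.refl (s n) (δ n)))

-- Unlike termwise nonnegativity of the sequence, this form is invariant under `_≃_`.
NonNeg : ℝ → Set
NonNeg x = ∀ ε → 0ℚ ℚ.< ε → ∃ λ N → ∀ n → N ℕ.≤ n → ℚ.- ε ℚ.< seq x n

NonNeg-pointwise : ∀ {x} → (∀ n → 0ℚ ℚ.≤ seq x n) → NonNeg x
NonNeg-pointwise 0≤x ε ε>0 = 0 , λ n _ → ℚ.<-≤-trans (ℚ.neg-antimono-< ε>0) (0≤x n)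

NonNeg-+ : ∀ {x y} → NonNeg x → NonNeg y → NonNeg (x +ℝ y)
NonNeg-+ {x} {y} hx hy ε ε>0 with hx (½ ℚ.* ε) (0<½ε ε>0) | hy (½ ℚ.* ε) (0<½ε ε>0)
... | M , p | N , q = M ℕ.⊔ N , λ n ≤n → ≡.subst (ℚ._< seq x n ℚ.+ seq y n)
  (≡.trans (≡.sym (ℚ.neg-distrib-+ (½ ℚ.* ε) (½ ℚ.* ε))) (≡.cong ℚ.-_ (½ε+½ε≡ε ε)))
  (ℚ.+-mono-< (p n (ℕ.m⊔n≤o⇒m≤o M N ≤n)) (q n (ℕ.m⊔n≤o⇒n≤o M N ≤n)))

Null⇒NonNeg : ∀ {x} → Null (seq x) → NonNeg x
Null⇒NonNeg {x} h ε ε>0 with h ε ε>0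
... | N , p = N , λ n ≤n → ≡.subst (ℚ.- ε ℚ.<_) (solve 1 (λ a → :- (:- a) := a) ≡.refl (seq x n))
  (ℚ.neg-antimono-< (ℚ.≤-<-trans (p≤∣p∣ (ℚ.- seq x n)) (≡.subst (ℚ._< ε) (≡.sym (ℚ.∣-p∣≡∣p∣ (seq x n))) (p n ≤n))))

NonNeg-resp : ∀ {x y} → x ≃ y → NonNeg x → NonNeg y
NonNeg-resp {x} {y} eq h ε ε>0 =
  let (N , p) = NonNeg-+ {x} {y +ℝ -ℝ x} h (Null⇒NonNeg {y +ℝ -ℝ x} (≃-sym {x} {y} eq)) ε ε>0
  in N , λ n ≤n → ≡.subst (ℚ.- ε ℚ.<_) (solve 2 (λ a b → a :+ (b :- a) := b) ≡.refl (seq x n) (seq y n)) (p n ≤n)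

0≤p² : ∀ p → 0ℚ ℚ.≤ p ℚ.* p
0≤p² p with ℚ.≤-total 0ℚ p
... | inj₁ 0≤p = ≡.subst (ℚ._≤ p ℚ.* p) (ℚ.*-zeroʳ p) (*-monoˡ-≤ 0≤p 0≤p)
... | inj₂ p≤0 = ≡.subst (0ℚ ℚ.≤_) (solve 1 (λ p → (:- p) :* (:- p) := p :* p) ≡.refl p)
  (≡.subst (ℚ._≤ (ℚ.- p) ℚ.* (ℚ.- p)) (ℚ.*-zeroʳ (ℚ.- p)) (*-monoˡ-≤ 0≤-p 0≤-p))
  where 0≤-p = ℚ.neg-antimono-≤ p≤0

fromℤ : ℤ → ℚ
fromℤ i = i ℚ./ 1

toℚᵘ-fromℤ : ∀ i → ℚ.toℚᵘ (fromℤ i) ℚᵘ.≃ ℚᵘ.mkℚᵘ i 0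
toℚᵘ-fromℤ i = ℚ.toℚᵘ-fromℚᵘ (ℚᵘ.mkℚᵘ i 0)

fromℤ-+ : ∀ i j → fromℤ (i ℤ.+ j) ≡ fromℤ i ℚ.+ fromℤ j
fromℤ-+ i j = ℚ.toℚᵘ-injective (ℚᵘ.≃-trans (toℚᵘ-fromℤ (i ℤ.+ j)) (ℚᵘ.≃-sym
  (ℚᵘ.≃-trans (ℚ.toℚᵘ-homo-+ (fromℤ i) (fromℤ j)) (ℚᵘ.≃-trans (ℚᵘ.+-cong (toℚᵘ-fromℤ i) (toℚᵘ-fromℤ j))
  (ℚᵘ.*≡* (≡.cong (ℤ._* + 1) (≡.cong₂ ℤ._+_ (ℤ.*-identityʳ i) (ℤ.*-identityʳ j))))))))

fromℤ-* : ∀ i j → fromℤ (i ℤ.* j) ≡ fromℤ i ℚ.* fromℤ j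
fromℤ-* i j = ℚ.toℚᵘ-injective (ℚᵘ.≃-trans (toℚᵘ-fromℤ (i ℤ.* j)) (ℚᵘ.≃-sym
  (ℚᵘ.≃-trans (ℚ.toℚᵘ-homo-* (fromℤ i) (fromℤ j)) (ℚᵘ.≃-trans (ℚᵘ.*-cong (toℚᵘ-fromℤ i) (toℚᵘ-fromℤ j))
  (ℚᵘ.*≡* ≡.refl)))))

fromℤ-neg : ∀ i → fromℤ (ℤ.- i) ≡ ℚ.- fromℤ i
fromℤ-neg i = ℚ.toℚᵘ-injective (ℚᵘ.≃-trans (toℚᵘ-fromℤ (ℤ.- i)) (ℚᵘ.≃-sym
  (ℚᵘ.≃-trans (ℚ.toℚᵘ-homo‿- (fromℤ i)) (ℚᵘ.-‿cong (toℚᵘ-fromℤ i)))))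

-- The complex numbers as a positive star ring

≃ℂ-isEquivalence : IsEquivalence _≃ℂ_
≃ℂ-isEquivalence = record
  { refl  = λ {z} → ≃-refl {re z} , ≃-refl {im z}
  ; sym   = λ {z} {w} (h , k) → ≃-sym {re z} {re w} h , ≃-sym {im z} {im w} k
  ; trans = λ {z} {w} {v} (h , k) (h′ , k′) →
      ≃-trans {re z} {re w} {re v} h h′ , ≃-trans {im z} {im w} {im v} k k′
  }

pointwiseℂ : ∀ {z w} → (∀ n → seq (re z) n ≡ seq (re w) n) → (∀ n → seq (im z) n ≡ seq (im w) n) → z ≃ℂ w
pointwiseℂ {z} {w} h k = pointwise {re z} {re w} h , pointwise {im z} {im w} k

+ℂ-cong : ∀ {x y u v} → x ≃ℂ y → u ≃ℂ v → x +ℂ u ≃ℂ y +ℂ v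
+ℂ-cong {x} {y} {u} {v} (h , h′) (k , k′) =
  +ℝ-cong {re x} {re y} {re u} {re v} h k , +ℝ-cong {im x} {im y} {im u} {im v} h′ k′

*ℂ-cong : ∀ {x y u v} → x ≃ℂ y → u ≃ℂ v → x *ℂ u ≃ℂ y *ℂ v
*ℂ-cong {x} {y} {u} {v} (h , h′) (k , k′) =
  +ℝ-cong {re x *ℝ re u} {re y *ℝ re v} { -ℝ (im x *ℝ im u)} { -ℝ (im y *ℝ im v)}
    (*ℝ-cong {re x} {re y} {re u} {re v} h k)
    (-ℝ-cong {im x *ℝ im u} {im y *ℝ im v} (*ℝ-cong {im x} {im y} {im u} {im v} h′ k′)) ,
  +ℝ-cong {re x *ℝ im u} {re y *ℝ im v} {im x *ℝ re u} {im y *ℝ re v}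
    (*ℝ-cong {re x} {re y} {im u} {im v} h k′) (*ℝ-cong {im x} {im y} {re u} {re v} h′ k)

-- The operations act termwise, so each law is a rational identity at every index; limits matter
-- only for the equivalence and congruence fields.
ℂ-commutativeRing : CommutativeRing 0ℓ 0ℓ
ℂ-commutativeRing = record
  { Carrier = ℂ ; _≈_ = _≃ℂ_ ; _+_ = _+ℂ_ ; _*_ = _*ℂ_ ; -_ = -ℂ_ ; 0# = 0ℂ ; 1# = 1ℂ
  ; isCommutativeRing = record
    { isRing = record
      { +-isAbelianGroup = record
        { isGroup = record
          { isMonoid = record
            { isSemigroup = record
              { isMagma = record { isEquivalence = ≃ℂ-isEquivalence ; ∙-cong = λ {x} {y} {u} {v} → +ℂ-cong {x} {y} {u} {v} }
              ; assoc = λ x y z → pointwiseℂ {x +ℂ y +ℂ z} {x +ℂ (y +ℂ z)}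
                  (λ n → ℚ.+-assoc (seq (re x) n) (seq (re y) n) (seq (re z) n))
                  (λ n → ℚ.+-assoc (seq (im x) n) (seq (im y) n) (seq (im z) n))
              }
            ; identity =
                (λ x → pointwiseℂ {0ℂ +ℂ x} {x} (λ n → ℚ.+-identityˡ _) (λ n → ℚ.+-identityˡ _)) ,
                (λ x → pointwiseℂ {x +ℂ 0ℂ} {x} (λ n → ℚ.+-identityʳ _) (λ n → ℚ.+-identityʳ _))
            }
          ; inverse =
              (λ x → pointwiseℂ { -ℂ x +ℂ x} {0ℂ} (λ n → ℚ.+-inverseˡ (seq (re x) n)) (λ n → ℚ.+-inverseˡ (seq (im x) n))) ,
              (λ x → pointwiseℂ {x +ℂ -ℂ x} {0ℂ} (λ n → ℚ.+-inverseʳ (seq (re x) n)) (λ n → ℚ.+-inverseʳ (seq (im x) n)))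
          ; ⁻¹-cong = λ {x} {y} (h , k) → -ℝ-cong {re x} {re y} h , -ℝ-cong {im x} {im y} k
          }
        ; comm = λ x y → pointwiseℂ {x +ℂ y} {y +ℂ x}
            (λ n → ℚ.+-comm (seq (re x) n) (seq (re y) n)) (λ n → ℚ.+-comm (seq (im x) n) (seq (im y) n))
        }
      ; *-cong = λ {x} {y} {u} {v} → *ℂ-cong {x} {y} {u} {v}
      ; *-assoc = λ x y z → pointwiseℂ {x *ℂ y *ℂ z} {x *ℂ (y *ℂ z)}
          (λ n → solve 6 (λ a b c d e f →
            (a :* c :- b :* d) :* e :- (a :* d :+ b :* c) :* f := a :* (c :* e :- d :* f) :- b :* (c :* f :+ d :* e)) ≡.refl
            (seq (re x) n) (seq (im x) n) (seq (re y) n) (seq (im y) n) (seq (re z) n) (seq (im z) n))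
          (λ n → solve 6 (λ a b c d e f →
            (a :* c :- b :* d) :* f :+ (a :* d :+ b :* c) :* e := a :* (c :* f :+ d :* e) :+ b :* (c :* e :- d :* f)) ≡.refl
            (seq (re x) n) (seq (im x) n) (seq (re y) n) (seq (im y) n) (seq (re z) n) (seq (im z) n))
      ; *-identity =
          (λ x → pointwiseℂ {1ℂ *ℂ x} {x}
            (λ n → solve 2 (λ a b → con 1ℚ :* a :- con 0ℚ :* b := a) ≡.refl (seq (re x) n) (seq (im x) n))
            (λ n → solve 2 (λ a b → con 1ℚ :* b :+ con 0ℚ :* a := b) ≡.refl (seq (re x) n) (seq (im x) n))) ,
          (λ x → pointwiseℂ {x *ℂ 1ℂ} {x}
            (λ n → solve 2 (λ a b → a :* con 1ℚ :- b :* con 0ℚ := a) ≡.refl (seq (re x) n) (seq (im x) n))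
            (λ n → solve 2 (λ a b → a :* con 0ℚ :+ b :* con 1ℚ := b) ≡.refl (seq (re x) n) (seq (im x) n)))
      ; distrib =
          (λ x y z → pointwiseℂ {x *ℂ (y +ℂ z)} {x *ℂ y +ℂ x *ℂ z}
            (λ n → solve 6 (λ a b c d e f → a :* (c :+ e) :- b :* (d :+ f) := (a :* c :- b :* d) :+ (a :* e :- b :* f)) ≡.refl
              (seq (re x) n) (seq (im x) n) (seq (re y) n) (seq (im y) n) (seq (re z) n) (seq (im z) n))
            (λ n → solve 6 (λ a b c d e f → a :* (d :+ f) :+ b :* (c :+ e) := (a :* d :+ b :* c) :+ (a :* f :+ b :* e)) ≡.refl
              (seq (re x) n) (seq (im x) n) (seq (re y) n) (seq (im y) n) (seq (re z) n) (seq (im z) n))) ,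
          (λ x y z → pointwiseℂ {(y +ℂ z) *ℂ x} {y *ℂ x +ℂ z *ℂ x}
            (λ n → solve 6 (λ a b c d e f → (c :+ e) :* a :- (d :+ f) :* b := (c :* a :- d :* b) :+ (e :* a :- f :* b)) ≡.refl
              (seq (re x) n) (seq (im x) n) (seq (re y) n) (seq (im y) n) (seq (re z) n) (seq (im z) n))
            (λ n → solve 6 (λ a b c d e f → (c :+ e) :* b :+ (d :+ f) :* a := (c :* b :+ d :* a) :+ (e :* b :+ f :* a)) ≡.refl
              (seq (re x) n) (seq (im x) n) (seq (re y) n) (seq (im y) n) (seq (re z) n) (seq (im z) n)))
      }
    ; *-comm = λ x y → pointwiseℂ {x *ℂ y} {y *ℂ x}
        (λ n → solve 4 (λ a b c d → a :* c :- b :* d := c :* a :- d :* b) ≡.refl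
          (seq (re x) n) (seq (im x) n) (seq (re y) n) (seq (im y) n))
        (λ n → solve 4 (λ a b c d → a :* d :+ b :* c := c :* b :+ d :* a) ≡.refl
          (seq (re x) n) (seq (im x) n) (seq (re y) n) (seq (im y) n))
    }
  }

ιℂ : ℤ → ℂ
ιℂ i = fromℚ (fromℤ i) +i 0ℝ

normSq : ℂ → ℝ
normSq z = re z *ℝ re z +ℝ im z *ℝ im z

*-conj : ∀ z → z *ℂ conj z ≃ℂ normSq z +i 0ℝ
*-conj z = pointwiseℂ {z *ℂ conj z} {normSq z +i 0ℝ}
  (λ n → solve 2 (λ a b → a :* a :- b :* (:- b) := a :* a :+ b :* b) ≡.refl (seq (re z) n) (seq (im z) n))
  (λ n → solve 2 (λ a b → a :* (:- b) :+ b :* a := con 0ℚ) ≡.refl (seq (re z) n) (seq (im z) n))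

normSq-nonNeg : ∀ z n → 0ℚ ℚ.≤ seq (normSq z) n
normSq-nonNeg z n = ℚ.+-mono-≤ (0≤p² (seq (re z) n)) (0≤p² (seq (im z) n))

divide-by-6 : ∀ {z} → ιℂ (+ 6) *ℂ z ≃ℂ ιℂ (+ 0) → z ≃ℂ ιℂ (+ 0)
divide-by-6 {z} h = trans {z} {⅙ *ℂ (ιℂ (+ 6) *ℂ z)} {ιℂ (+ 0)}
  (pointwiseℂ {z} {⅙ *ℂ (ιℂ (+ 6) *ℂ z)}
    (λ n → solve 2 (λ a b → a := con sixth :* (con six :* a :- con 0ℚ :* b) :- con 0ℚ :* (con six :* b :+ con 0ℚ :* a)) ≡.refl
      (seq (re z) n) (seq (im z) n))
    (λ n → solve 2 (λ a b → b := con sixth :* (con six :* b :+ con 0ℚ :* a) :+ con 0ℚ :* (con six :* a :- con 0ℚ :* b)) ≡.refl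
      (seq (re z) n) (seq (im z) n)))
  (trans {⅙ *ℂ (ιℂ (+ 6) *ℂ z)} {⅙ *ℂ ιℂ (+ 0)} {ιℂ (+ 0)}
    (*ℂ-cong {⅙} {⅙} {ιℂ (+ 6) *ℂ z} {ιℂ (+ 0)} (refl {⅙}) h)
    (pointwiseℂ {⅙ *ℂ ιℂ (+ 0)} {ιℂ (+ 0)} (λ _ → ≡.refl) (λ _ → ≡.refl)))
  where
  open IsEquivalence ≃ℂ-isEquivalence using (refl; trans)
  six sixth : ℚ
  six   = fromℤ (+ 6)
  sixth = + 1 ℚ./ 6
  ⅙ : ℂ
  ⅙ = fromℚ sixth +i 0ℝ

-1-not-NonNeg : ¬ NonNeg (fromℚ (fromℤ -[1+ 0 ]))
-- With ε = ½ the constant sequence -1 would have to exceed -½.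
-1-not-NonNeg h = let (N , p) = h ½ (ℚ.positive⁻¹ ½) in
  ℚ.<-asym (p N ℕ.≤-refl) (ℚ.neg-antimono-< {½} {1ℚ} (ℚ.*<* (ℤ.+<+ (ℕ.s≤s (ℕ.s≤s ℕ.z≤n)))))

ℂ-isPositiveStarRing : IsPositiveStarRing _≃ℂ_ _+ℂ_ _*ℂ_ -ℂ_ 0ℂ 1ℂ ιℂ conj (λ z → NonNeg (re z))
ℂ-isPositiveStarRing = record
  { isCommutativeRing = CommutativeRing.isCommutativeRing ℂ-commutativeRing
  ; ι-+ = λ i j → pointwiseℂ {ιℂ (i ℤ.+ j)} {ιℂ i +ℂ ιℂ j} (λ _ → fromℤ-+ i j) (λ _ → ≡.refl)
  ; ι-* = λ i j → pointwiseℂ {ιℂ (i ℤ.* j)} {ιℂ i *ℂ ιℂ j}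
      (λ _ → ≡.trans (fromℤ-* i j) (solve 2 (λ a b → a :* b := a :* b :- con 0ℚ :* con 0ℚ) ≡.refl (fromℤ i) (fromℤ j)))
      (λ _ → solve 2 (λ a b → con 0ℚ := a :* con 0ℚ :+ con 0ℚ :* b) ≡.refl (fromℤ i) (fromℤ j))
  ; ι-neg = λ i → pointwiseℂ {ιℂ (ℤ.- i)} { -ℂ ιℂ i} (λ _ → fromℤ-neg i) (λ _ → ≡.refl)
  ; ι-0 = pointwiseℂ {ιℂ (+ 0)} {0ℂ} (λ _ → ≡.refl) (λ _ → ≡.refl)
  ; ι-1 = pointwiseℂ {ιℂ (+ 1)} {1ℂ} (λ _ → ≡.refl) (λ _ → ≡.refl)
  ; ᶜ-cong = λ {z} {w} (h , k) → h , -ℝ-cong {im z} {im w} k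
  ; ᶜ-+ = λ z w → pointwiseℂ {conj (z +ℂ w)} {conj z +ℂ conj w} (λ _ → ≡.refl)
      (λ n → ℚ.neg-distrib-+ (seq (im z) n) (seq (im w) n))
  ; ᶜ-* = λ z w → pointwiseℂ {conj (z *ℂ w)} {conj z *ℂ conj w}
      (λ n → solve 4 (λ a b c d → a :* c :- b :* d := a :* c :- (:- b) :* (:- d)) ≡.refl
        (seq (re z) n) (seq (im z) n) (seq (re w) n) (seq (im w) n))
      (λ n → solve 4 (λ a b c d → :- (a :* d :+ b :* c) := a :* (:- d) :+ (:- b) :* c) ≡.refl
        (seq (re z) n) (seq (im z) n) (seq (re w) n) (seq (im w) n))
  ; ᶜ-neg = λ z → pointwiseℂ {conj (-ℂ z)} { -ℂ conj z} (λ _ → ≡.refl) (λ _ → ≡.refl)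
  ; ᶜ-ι = λ i → pointwiseℂ {conj (ιℂ i)} {ιℂ i} (λ _ → ≡.refl) (λ _ → ≡.refl)
  ; ᶜ-invol = λ z → pointwiseℂ {conj (conj z)} {z} (λ _ → ≡.refl)
      (λ n → solve 1 (λ b → :- (:- b) := b) ≡.refl (seq (im z) n))
  ; Pos-resp = λ {z} {w} (h , _) → NonNeg-resp {re z} {re w} h
  ; Pos-+ = λ {z} {w} → NonNeg-+ {re z} {re w}
  ; Pos-sq = λ z → NonNeg-resp {normSq z} {re (z *ℂ conj z)} (≃-sym {re (z *ℂ conj z)} {normSq z} (proj₁ (*-conj z)))
      (NonNeg-pointwise {normSq z} (normSq-nonNeg z))
  ; ¬Pos-neg = -1-not-NonNeg
  ; cancel₆ = λ {z} → divide-by-6 {z}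
  }

-- The ring operations are sealed: conversion checking must not unfold them to the
-- underlying Cauchy sequences together with their convergence proofs.

infix  8 ⊟_
infixl 7 _⊠_
infixl 6 _⊞_

opaque
  _⊞_ _⊠_ : ℂ → ℂ → ℂ
  _⊞_ = _+ℂ_
  _⊠_ = _*ℂ_

  ⊟_ conjˢ : ℂ → ℂ
  ⊟_ = -ℂ_
  conjˢ = conj

  0ˢ 1ˢ : ℂ
  0ˢ = 0ℂ
  1ˢ = 1ℂ

  ιˢ : ℤ → ℂ
  ιˢ = ιℂ

  sealed-isPositiveStarRing : IsPositiveStarRing _≃ℂ_ _⊞_ _⊠_ ⊟_ 0ˢ 1ˢ ιˢ conjˢ (λ z → NonNeg (re z))
  sealed-isPositiveStarRing = ℂ-isPositiveStarRing

  -- This and the following equations, proved where the seal is transparent, carry facts about the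
  -- original operations across it.
  ⊞-def : ∀ z w → z +ℂ w ≡ z ⊞ w
  ⊞-def z w = ≡.refl

  ⊠-def : ∀ z w → z *ℂ w ≡ z ⊠ w
  ⊠-def z w = ≡.refl

  ⊟-def : ∀ z → -ℂ z ≡ ⊟ z
  ⊟-def z = ≡.refl

  conjˢ-def : ∀ z → conj z ≡ conjˢ z
  conjˢ-def z = ≡.refl

  0ˢ-def : 0ℂ ≡ 0ˢ
  0ˢ-def = ≡.refl

  ιˢ-def : ∀ i → ιℂ i ≡ ιˢ i
  ιˢ-def i = ≡.refl

ℂ-positiveStarRing : PositiveStarRing
ℂ-positiveStarRing = record { isPositiveStarRing = sealed-isPositiveStarRing }

∣∣-square : ∀ z c → ∣ z ∣ *ℝ ∣ z ∣ ≃ fromℚ c → z *ℂ conj z ≃ℂ fromℚ c +i 0ℝ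
∣∣-square z c h =
  ≃-trans {re (z *ℂ conj z)} {normSq z} {fromℚ c} (proj₁ (*-conj z))
    (≃-trans {normSq z} {∣ z ∣ *ℝ ∣ z ∣} {fromℚ c}
      (≃-sym {∣ z ∣ *ℝ ∣ z ∣} {normSq z} (√-square (normSq z) (normSq-nonNeg z))) h) ,
  proj₂ (*-conj z)

√fromℚ-square : ∀ c → 0ℚ ℚ.≤ c → √ fromℚ c *ℝ √ fromℚ c ≃ fromℚ c
√fromℚ-square c 0≤c = √-square (fromℚ c) (λ _ → 0≤c)

0≤fromℕ : ∀ n → 0ℚ ℚ.≤ fromℤ (+ n)
0≤fromℕ n = ℚ-lemmas.0≤grid 0 n

unimodular : ∀ {z} → ∣ z ∣ ≃ 1ℝ → z *ℂ conj z ≃ℂ ιℂ (+ 1)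
unimodular {z} h = ∣∣-square z (fromℤ (+ 1))
  (≃-trans {∣ z ∣ *ℝ ∣ z ∣} {1ℝ *ℝ 1ℝ} {1ℝ} (*ℝ-cong {∣ z ∣} {1ℝ} {∣ z ∣} {1ℝ} h h)
    (pointwise {1ℝ *ℝ 1ℝ} {1ℝ} (λ _ → ≡.refl)))

modulus-√ : ∀ {z} n → ∣ z ∣ ≃ √ fromℕ n → z *ℂ conj z ≃ℂ ιℂ (+ n)
modulus-√ {z} n h = ∣∣-square z (fromℤ (+ n))
  (≃-trans {∣ z ∣ *ℝ ∣ z ∣} {√ fromℕ n *ℝ √ fromℕ n} {fromℕ n}
    (*ℝ-cong {∣ z ∣} {√ fromℕ n} {∣ z ∣} {√ fromℕ n} h h) (√fromℚ-square (fromℤ (+ n)) (0≤fromℕ n)))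

1+ω+ω⁻¹ : ιℂ (+ 1) +ℂ ω +ℂ conj ω ≃ℂ ιℂ (+ 0)
1+ω+ω⁻¹ = pointwiseℂ {ιℂ (+ 1) +ℂ ω +ℂ conj ω} {ιℂ (+ 0)} (λ _ → ≡.refl)
  (λ n → solve 1 (λ h → con 0ℚ :+ h :- h := con 0ℚ) ≡.refl (seq (im ω) n))

ω*ω⁻¹ : ω *ℂ conj ω ≃ℂ ιℂ (+ 1)
ω*ω⁻¹ = pointwise′ , proj₂ (*-conj ω)
  where
  ¼ : ℝ
  ¼ = fromℚ (½ ℚ.* ½)
  s = √ fromℕ 3
  pointwise′ : re (ω *ℂ conj ω) ≃ re (ιℂ (+ 1))
  pointwise′ = ≃-trans {re (ω *ℂ conj ω)} {¼ +ℝ ¼ *ℝ (s *ℝ s)} {fromℚ (fromℤ (+ 1))}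
    (pointwise {re (ω *ℂ conj ω)} {¼ +ℝ ¼ *ℝ (s *ℝ s)} (λ n → solve 1 (λ t →
      con ℚ.-½ :* con ℚ.-½ :- (con ½ :* t) :* (:- (con ½ :* t)) :=
      con (½ ℚ.* ½) :+ con (½ ℚ.* ½) :* (t :* t)) ≡.refl (seq s n)))
    (≃-trans {¼ +ℝ ¼ *ℝ (s *ℝ s)} {¼ +ℝ ¼ *ℝ fromℕ 3} {fromℚ (fromℤ (+ 1))}
      (+ℝ-cong {¼} {¼} {¼ *ℝ (s *ℝ s)} {¼ *ℝ fromℕ 3} (≃-refl {¼})
        (*ℝ-cong {¼} {¼} {s *ℝ s} {fromℕ 3} (≃-refl {¼}) (√fromℚ-square (fromℤ (+ 3)) (0≤fromℕ 3))))
      (pointwise {¼ +ℝ ¼ *ℝ fromℕ 3} {fromℚ (fromℤ (+ 1))} (λ _ → ≡.refl)))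

-- Transfer of the complex data to the sealed ring

module Mℂ = MultiSum ℂ-positiveStarRing
module Dℂ = Design ℂ-positiveStarRing
module Cℂ = Core ℂ-positiveStarRing

-- Original and sealed inner products differ in operation, unit and summands, each only up to
-- pointwise equality; induction replaces function extensionality.
foldr-cong : ∀ {A B : Set} {_∙_ _∘_ : A → B → B} {e e′ : B} → (∀ x y → x ∙ y ≡ x ∘ y) → e ≡ e′ →
  ∀ {n} {u v : Vector A n} → (∀ i → u i ≡ v i) → V.foldr _∙_ e u ≡ V.foldr _∘_ e′ v
foldr-cong ∙≡∘ e≡ {zero}  u≡v = e≡
foldr-cong {_∙_ = _∙_} ∙≡∘ e≡ {suc n} {u} {v} u≡v =
  ≡.trans (≡.cong₂ _∙_ (u≡v zero) (foldr-cong ∙≡∘ e≡ (λ i → u≡v (suc i)))) (∙≡∘ _ _)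

agree₁ : ∀ {A : Set} (f g : A → A) → (∀ x → f x ≡ g x) → ∀ {x x′} → x ≡ x′ → f x ≡ g x′
agree₁ f g f≡g ≡.refl = f≡g _

agree₂ : ∀ {A : Set} (f g : A → A → A) → (∀ x y → f x y ≡ g x y) → ∀ {x x′ y y′} → x ≡ x′ → y ≡ y′ → f x y ≡ g x′ y′
agree₂ f g f≡g ≡.refl ≡.refl = f≡g _ _

⊞-cong : ∀ {z z′ w w′} → z ≡ z′ → w ≡ w′ → z +ℂ w ≡ z′ ⊞ w′
⊞-cong = agree₂ _+ℂ_ _⊞_ ⊞-def

⊠-cong : ∀ {z z′ w w′} → z ≡ z′ → w ≡ w′ → z *ℂ w ≡ z′ ⊠ w′
⊠-cong = agree₂ _*ℂ_ _⊠_ ⊠-def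

⊟-cong : ∀ {z z′} → z ≡ z′ → -ℂ z ≡ ⊟ z′
⊟-cong = agree₁ -ℂ_ ⊟_ ⊟-def

inner-sealed : ∀ {n} (u w : Vector ℂ n) → ⟨ u , w ⟩ ≡ Mℂ.⟪_,_⟫ u w
inner-sealed u w = foldr-cong {_∙_ = _+ℂ_} {_⊞_} {0ℂ} {0ˢ} ⊞-def 0ˢ-def
  {u = V.zipWith (λ x y → conj x *ℂ y) u w} {V.zipWith (λ x y → conjˢ x ⊠ y) u w}
  (λ i → ⊠-cong {conj (u i)} {conjˢ (u i)} {w i} {w i} (conjˢ-def (u i)) ≡.refl)

norm-sealed : ∀ {z} {i} → z *ℂ conj z ≃ℂ ιℂ i → z ⊠ conjˢ z ≃ℂ ιˢ i
norm-sealed {z} {i} = ≡.subst₂ _≃ℂ_ (⊠-cong {z} {z} {conj z} {conjˢ z} ≡.refl (conjˢ-def z)) (ιˢ-def i)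

sealed-ω : ιˢ (+ 1) ⊞ ω ⊞ conjˢ ω ≃ℂ ιˢ (+ 0)
sealed-ω = ≡.subst₂ _≃ℂ_
  (⊞-cong {ιℂ (+ 1) +ℂ ω} {ιˢ (+ 1) ⊞ ω} {conj ω} {conjˢ ω}
    (⊞-cong {ιℂ (+ 1)} {ιˢ (+ 1)} {ω} {ω} (ιˢ-def (+ 1)) ≡.refl) (conjˢ-def ω))
  (ιˢ-def (+ 0)) 1+ω+ω⁻¹

module Fℂ = Cℂ.Fourier ω sealed-ω (norm-sealed {ω} {+ 1} ω*ω⁻¹)

f₀-sealed : ∀ i → f₀ i ≡ Fℂ.f₀ i
f₀-sealed 0F = ιˢ-def (+ 1)
f₀-sealed 1F = ιˢ-def (+ 1)
f₀-sealed 2F = ιˢ-def (+ 1)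

f₁-sealed : ∀ i → f₁ i ≡ Fℂ.f₁ i
f₁-sealed 0F = ιˢ-def (+ 1)
f₁-sealed 1F = ≡.refl
f₁-sealed 2F = conjˢ-def ω

f₂-sealed : ∀ i → f₂ i ≡ Fℂ.f₂ i
f₂-sealed 0F = ιˢ-def (+ 1)
f₂-sealed 1F = conjˢ-def ω
f₂-sealed 2F = ≡.refl

Fᵀ-sealed : ∀ a b k i → Fᵀ-columns a b k i ≡ Fℂ.Fᵀ-columns a b k i
Fᵀ-sealed a b = λ
  { 0F → ++-cong f₀ Fℂ.f₀ f₀-sealed f₀-sealed
  ; 1F → ++-cong f₀ Fℂ.f₀ f₀-sealed (λ i → ⊟-cong {f₀ i} {Fℂ.f₀ i} (f₀-sealed i))
  ; 2F → ++-cong f₁ Fℂ.f₁ f₁-sealed (scaled a f₁-sealed)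
  ; 3F → ++-cong f₁ Fℂ.f₁ f₁-sealed (scaled-neg a f₁-sealed)
  ; 4F → ++-cong f₂ Fℂ.f₂ f₂-sealed (scaled b f₂-sealed)
  ; 5F → ++-cong f₂ Fℂ.f₂ f₂-sealed (scaled-neg b f₂-sealed)
  }
  where
  scaled : ∀ c {f g : Vector ℂ 3} → (∀ i → f i ≡ g i) → ∀ i → c *ℂ f i ≡ c ⊠ g i
  scaled c {f} {g} eq i = ⊠-cong {c} {c} {f i} {g i} ≡.refl (eq i)
  scaled-neg : ∀ c {f g : Vector ℂ 3} → (∀ i → f i ≡ g i) → ∀ i → (-ℂ c) *ℂ f i ≡ (⊟ c) ⊠ g i
  scaled-neg c {f} {g} eq i = ⊠-cong { -ℂ c} {⊟ c} {f i} {g i} (⊟-def c) (eq i)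

columns : Vector (Matrix 6) 6 → Fin 6 → Fin 6 → Vector ℂ 6
columns Hs j = column (Hs j)

system : ∀ {Hs : Vector (Matrix 6) 6} → IsFullMUHSystem Hs → Dℂ.System (columns Hs)
system {Hs} (hadamard , unbiased) = record
  { unit       = λ j k i → norm-sealed {Hs j i k} {+ 1} (unimodular {Hs j i k} (proj₁ (hadamard j) i k))
  ; orthogonal = λ j {k} {k′} k≢k′ → ≡.subst₂ _≃ℂ_
      (inner-sealed (columns Hs j k) (columns Hs j k′)) (≡.trans 0ℂ≡ (ιˢ-def (+ 0)))
      (proj₂ (hadamard j) k k′ k≢k′)
  ; unbiased   = λ {j} {j′} j≢j′ k k′ → let z = Mℂ.⟪_,_⟫ (columns Hs j k) (columns Hs j′ k′) in
      norm-sealed {z} {+ 6} (modulus-√ {z} 6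
        (≡.subst (λ z → ∣ z ∣ ≃ √ fromℕ 6) (inner-sealed (columns Hs j k) (columns Hs j′ k′)) (unbiased j j′ j≢j′ k k′)))
  }
  where
  0ℂ≡ : 0ℂ ≡ ιℂ (+ 0)
  0ℂ≡ = ≡.refl

theorem4p1 : ∀ (a b : ℂ) → ∣ a ∣ ≃ 1ℝ → ∣ b ∣ ≃ 1ℝ →
    ¬ ExtendsToFullMUHSystem (F a b) × ¬ ExtendsToFullMUHSystem (Fᵀ a b)
theorem4p1 a b ∣a∣≃1 ∣b∣≃1 =
  -- Column k of `F a b` is row k of `Fᵀ a b`, hence the exchanged indices.
  (λ (Hs , full) → Fℂ.Direct.not-extendable a b ua ub (system {F a b V.∷ Hs} full) (λ k i → Fᵀ-sealed a b i k)) ,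
  (λ (Hs , full) → Fℂ.Transposed.not-extendable a b ua ub (system {Fᵀ a b V.∷ Hs} full) (λ k i → Fᵀ-sealed a b k i))
  where
  ua = norm-sealed {a} {+ 1} (unimodular {a} ∣a∣≃1)
  ub = norm-sealed {b} {+ 1} (unimodular {b} ∣b∣≃1)
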